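{- Let $n,N$ be positive integers with $N=rn$, where $r$ is a prime power and $r$ divides $n$. Then for every $p$ (indeed for every outcome of $G(N,p)$), $c(G(N,p),P_{n+1})\le r+1$; that is, the edges of $G(N,p)$ can be colored with $r+1$ colors so that no color class contains a copy of $P_{n+1}$.
   Context: $G(N,p)$ denotes the Erdős–Rényi random graph on vertex set $[N]$ in which each pair is an edge independently with probability $p$. $P_k$ denotes the path on $k$ vertices. For graphs $G,F$, $c(G,F)$ denotes the minimum number $k$ of colors such that there exists a $k$-coloring of the edges of $G$ with no monochromatic copy of $F$. -}

module Defs where

open import Data.Nat using (ℕ; suc; _^_; _≥_)
open import Data.Nat.Primality using (Prime)
open import Data.Fin using (Fin; inject₁) renaming (suc to fsuc)
open import Data.Product using (Σ; ∃; _×_)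
open import Function.Definitions using (Injective)
open import Relation.Binary.PropositionalEquality using (_≡_)
open import Relation.Nullary using (¬_)

-- A finite simple graph on vertex set Fin N (an outcome of G(N,p)):
-- a symmetric, irreflexive adjacency relation.
record SimpleGraph (N : ℕ) : Set₁ where
  field
    Adj   : Fin N → Fin N → Set
    sym   : ∀ {u v} → Adj u v → Adj v u
    irrefl : ∀ {u} → ¬ Adj u u

IsPrimePower : ℕ → Set
IsPrimePower r = ∃ λ p → ∃ λ k → Prime p × k ≥ 1 × r ≡ p ^ k

record EdgeColouring {N : ℕ} (G : SimpleGraph N) (k : ℕ) : Set where
  open SimpleGraph G
  field
    colour : ∀ {u v} → Adj u v → Fin k
    colour-sym : ∀ {u v} (e : Adj u v) → colour (sym e) ≡ colour e

record MonoPath {N : ℕ} {G : SimpleGraph N} {k : ℕ} (χ : EdgeColouring G k)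
                (c : Fin k) (m : ℕ) : Set where
  open SimpleGraph G
  open EdgeColouring χ
  field
    vertex : Fin (suc m) → Fin N
    injective : Injective _≡_ _≡_ vertex
    edge : ∀ (i : Fin m) → Adj (vertex (inject₁ i)) (vertex (fsuc i))
    edge-colour : ∀ (i : Fin m) → colour (edge i) ≡ c

-- MonoPath χ c m encodes a path with m edges, i.e. P_(m+1).
-- G admits a k-colouring with no monochromatic P_(m+1):
NoMonoPathColouring : ∀ {N} → SimpleGraph N → (k m : ℕ) → Set
NoMonoPathColouring G k m =
  Σ (EdgeColouring G k) λ χ → ∀ (c : Fin k) → ¬ MonoPath χ c m

{-# OPTIONS --safe #-}

-- For r = p^k, the affine plane of order r has r² points and r + 1 parallel classes, each made of r lines
-- with r points.  Blowing up every point to n / r vertices and colouring an edge by the direction of the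
-- line through its ends, a monochromatic path stays inside one line, which has only n vertices.
--
-- The plane needs the roots of X^r - X in characteristic p.  Adjoining a root of a monic polynomial f to
-- a nontrivial ring R gives a nontrivial ring: let X act as the shift on a linear recurrent sequence with
-- characteristic polynomial f and an entry 1, and take R[X] modulo the annihilator of that sequence.
-- Iterating from ℤ/p, X^r - X splits in some ring S; its derivative is -1, so differences of distinct
-- roots are invertible.  The roots need not be closed under the field operations in S, but modulo a
-- suitable proper ideal they are: if a product vanishes, then classically some factor generates a proper
-- ideal.  Since a plane on Fin r × Fin r is finite data, this double-negated existence suffices.
module Submission where

open import Algebra.Bundles using (CommutativeRing)
import Algebra.Morphism.Construct.Composition as Composition
import Algebra.Morphism.Construct.Identity as Identity
open import Algebra.Morphism.Structures using (IsRingHomomorphism)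
import Algebra.Properties.AbelianGroup
import Algebra.Properties.CommutativeSemiring.Binomial
import Algebra.Properties.CommutativeSemiring.Exp
import Algebra.Properties.Ring
import Algebra.Properties.Semiring.Exp
import Algebra.Properties.Semiring.Mult
import Algebra.Properties.Semiring.Mult.TCOptimised
import Algebra.Properties.Semiring.Sum
import Algebra.Solver.Ring
open import Algebra.Solver.Ring.AlmostCommutativeRing using (_-Raw-AlmostCommutative⟶_; fromCommutativeRing)
open import Algebra.Structures using (IsCommutativeRing)
open import Data.Fin.Base as Fin using (Fin; zero; suc; toℕ; fromℕ; inject₁; combine; remQuot; finToFun; funToFin)
import Data.Fin.Properties as Fin
open import Data.Integer.Base as ℤ using (ℤ; -[1+_]; _⊖_)
import Data.Integer.Properties as ℤ
open import Data.List.Base as List using (List; []; _∷_; _++_; allFin; cartesianProduct)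
open import Data.List.Membership.Propositional using (_∈_)
open import Data.List.Membership.Propositional.Properties using (∈-map⁺; ∈-++⁺ˡ; ∈-++⁺ʳ; ∈-allFin; ∈-cartesianProduct⁺)
open import Data.List.Relation.Unary.All as All using (All; []; _∷_)
import Data.List.Relation.Unary.All.Properties as All
open import Data.List.Relation.Unary.Any using (here; there)
import Data.Maybe.Base as Maybe
open import Data.Nat.Base as ℕ using (ℕ; zero; suc; _!; _≥_; _<_; s≤s; z<s; s<s)
open import Data.Nat.Combinatorics using (_C_; nCk≡n!/k![n-k]!; k![n∸k]!∣n!; nCn≡1)
open import Data.Nat.Divisibility using (_∣_; divides; ∣1⇒≡1; >⇒∤; m∣m*n)
open import Data.Nat.DivMod using (m/n*n≡m)
open import Data.Nat.Primality using (Prime; euclidsLemma; prime⇒nonTrivial; prime⇒nonZero)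
import Data.Nat.Properties as ℕ
open import Data.Product.Base using (∃; Σ; _×_; _,_; proj₁; proj₂; uncurry)
open import Data.Sum.Base using (inj₁; inj₂)
open import Data.Vec.Base as Vec using (Vec; []; _∷_; _∷ʳ_; lookup; replicate)
open import Data.Vec.Properties using (map-∘; lookup-map)
open import Data.Vec.Relation.Binary.Pointwise.Inductive using (Pointwise; []; _∷_)
open import Function.Base using (_∘_; id)
open import Level using (0ℓ)
open import Relation.Binary.Consequences using (dec⇒weaklyDec)
open import Relation.Binary.PropositionalEquality as ≡ using (_≡_; _≢_)
import Relation.Binary.Reasoning.Setoid
open import Relation.Nullary.Decidable using (Dec; yes; no; decidable-stable; ¬¬-excluded-middle; ¬?; _→-dec_; _×-dec_)
open import Relation.Nullary.Negation using (¬_; contradiction)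

open import Defs

-- Integer coefficients for the ring solver

module IntegerCoefficients (R : CommutativeRing 0ℓ 0ℓ) where
  open CommutativeRing R
  open import Data.Integer.Base using (+_)
  open Algebra.Properties.Ring ring
  open Algebra.Properties.AbelianGroup +-abelianGroup using (⁻¹-∙-comm)
  open Algebra.Properties.Semiring.Mult.TCOptimised semiring renaming (_×_ to _·_)
  open Relation.Binary.Reasoning.Setoid setoid

  -- Equality in `R` need not be decidable, so the solver compares coefficients in ℤ. The optimised
  -- multiple reduces `1 · x` to `x`, which makes `con (+ 1)` denote `1#` itself.
  fromℤ : ℤ → Carrier
  fromℤ (+ n)    = n · 1#
  fromℤ -[1+ n ] = - (suc n · 1#)

  fromℤ-⊖ : ∀ m n → fromℤ (m ⊖ n) ≈ m · 1# - n · 1#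
  fromℤ-⊖ m zero = begin
    m · 1#       ≈⟨ +-identityʳ _ ⟨
    m · 1# + 0#  ≈⟨ +-congˡ -0#≈0# ⟨
    m · 1# - 0#  ∎
  fromℤ-⊖ zero (suc n) = sym (+-identityˡ _)
  fromℤ-⊖ (suc m) (suc n) = begin
    fromℤ (suc m ⊖ suc n)                 ≡⟨ ≡.cong fromℤ (ℤ.[1+m]⊖[1+n]≡m⊖n m n) ⟩
    fromℤ (m ⊖ n)                         ≈⟨ fromℤ-⊖ m n ⟩
    m · 1# - n · 1#                       ≈⟨ +-congʳ (xyx⁻¹≈y 1# (m · 1#)) ⟨
    (1# + m · 1# - 1#) - n · 1#           ≈⟨ +-assoc _ _ _ ⟩
    (1# + m · 1#) + (- 1# - n · 1#)       ≈⟨ +-congˡ (⁻¹-∙-comm 1# (n · 1#)) ⟩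
    (1# + m · 1#) - (1# + n · 1#)         ≈⟨ +-cong (1+× m 1#) (-‿cong (1+× n 1#)) ⟨
    suc m · 1# - suc n · 1#               ∎

  fromℤ-+ : ∀ i j → fromℤ (i ℤ.+ j) ≈ fromℤ i + fromℤ j
  fromℤ-+ (+ m)    (+ n)    = ×-homo-+ 1# m n
  fromℤ-+ (+ m)    -[1+ n ] = fromℤ-⊖ m (suc n)
  fromℤ-+ -[1+ m ] (+ n)    = trans (fromℤ-⊖ n (suc m)) (+-comm _ _)
  fromℤ-+ -[1+ m ] -[1+ n ] = begin
    - (suc (suc (m ℕ.+ n)) · 1#)      ≈⟨ -‿cong (×-cong (≡.cong suc (≡.sym (ℕ.+-suc m n))) refl) ⟩
    - ((suc m ℕ.+ suc n) · 1#)        ≈⟨ -‿cong (×-homo-+ 1# (suc m) (suc n)) ⟩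
    - (suc m · 1# + suc n · 1#)       ≈⟨ ⁻¹-∙-comm _ _ ⟨
    - (suc m · 1#) - suc n · 1#       ∎

  fromℤ-neg : ∀ i → fromℤ (ℤ.- i) ≈ - fromℤ i
  fromℤ-neg (+ zero)  = sym -0#≈0#
  fromℤ-neg (+ suc n) = refl
  fromℤ-neg -[1+ n ]  = sym (-‿involutive _)

  fromℤ-*-+ : ∀ i n → fromℤ (i ℤ.* + n) ≈ fromℤ i * (n · 1#)
  fromℤ-*-+ (+ m) n = begin
    fromℤ (+ m ℤ.* + n)  ≡⟨ ≡.cong fromℤ (ℤ.pos-* m n) ⟨
    (m ℕ.* n) · 1#       ≈⟨ ×1-homo-* m n ⟩
    m · 1# * (n · 1#)    ∎
  fromℤ-*-+ -[1+ m ] n = begin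
    fromℤ (-[1+ m ] ℤ.* + n)       ≡⟨ ≡.cong fromℤ (ℤ.neg-distribˡ-* (+ suc m) (+ n)) ⟨
    fromℤ (ℤ.- (+ suc m ℤ.* + n))  ≈⟨ fromℤ-neg (+ suc m ℤ.* + n) ⟩
    - fromℤ (+ suc m ℤ.* + n)      ≈⟨ -‿cong (fromℤ-*-+ (+ suc m) n) ⟩
    - ((suc m · 1#) * (n · 1#))    ≈⟨ -‿distribˡ-* _ _ ⟩
    - (suc m · 1#) * (n · 1#)      ∎

  fromℤ-* : ∀ i j → fromℤ (i ℤ.* j) ≈ fromℤ i * fromℤ j
  fromℤ-* i (+ n)    = fromℤ-*-+ i n
  fromℤ-* i -[1+ n ] = begin
    fromℤ (i ℤ.* -[1+ n ])       ≡⟨ ≡.cong fromℤ (ℤ.neg-distribʳ-* i (+ suc n)) ⟨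
    fromℤ (ℤ.- (i ℤ.* + suc n))  ≈⟨ fromℤ-neg (i ℤ.* + suc n) ⟩
    - fromℤ (i ℤ.* + suc n)      ≈⟨ -‿cong (fromℤ-*-+ i (suc n)) ⟩
    - (fromℤ i * (suc n · 1#))   ≈⟨ -‿distribʳ-* _ _ ⟩
    fromℤ i * - (suc n · 1#)     ∎

  morphism : ℤ.+-*-rawRing -Raw-AlmostCommutative⟶ fromCommutativeRing R
  morphism = record
    { ⟦_⟧    = fromℤ
    ; +-homo = fromℤ-+
    ; *-homo = fromℤ-*
    ; -‿homo = fromℤ-neg
    ; 0-homo = refl
    ; 1-homo = refl
    }

  open Algebra.Solver.Ring ℤ.+-*-rawRing (fromCommutativeRing R) morphism
    (λ i j → Maybe.map (λ eq → reflexive (≡.cong fromℤ eq)) (dec⇒weaklyDec ℤ._≟_ i j)) public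

  :0 :1 : ∀ {n} → Polynomial n
  :0 = con (+ 0)
  :1 = con (+ 1)

-- Monic polynomials: roots, derivatives and splitting

-- The vector (c₀, …, c_{d-1}) stands for the monic polynomial c₀ + c₁X + … + X^d.
module MonicPolynomial (R : CommutativeRing 0ℓ 0ℓ) where
  open CommutativeRing R
  open IntegerCoefficients R using (solve; :0; :1; _:+_; _:*_; _:-_; _:=_)
  open Relation.Binary.Reasoning.Setoid setoid

  eval : ∀ {d} → Vec Carrier d → Carrier → Carrier
  eval []      x = 1#
  eval (c ∷ f) x = c + x * eval f x

  eval-cong : ∀ {d} {f g : Vec Carrier d} x → Pointwise _≈_ f g → eval f x ≈ eval g x
  eval-cong x []        = refl
  eval-cong x (c≈ ∷ f≈) = +-cong c≈ (*-congˡ (eval-cong x f≈))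

  -- The product rule for `c + X * f` gives the formal derivative without integer multiples of the
  -- coefficients.
  deriv : ∀ {d} → Vec Carrier d → Carrier → Carrier
  deriv []      x = 0#
  deriv (c ∷ f) x = eval f x + x * deriv f x

  deriv-cong : ∀ {d} {f g : Vec Carrier d} x → Pointwise _≈_ f g → deriv f x ≈ deriv g x
  deriv-cong x []       = refl
  deriv-cong x (_ ∷ f≈) = +-cong (eval-cong x f≈) (*-congˡ (deriv-cong x f≈))

  -- Synthetic division by `X - a`: the coefficients of the quotient are the values at `a` of the
  -- successive tails. The remainder is the value of the whole polynomial at `a`.
  divide : ∀ {d} → Carrier → Vec Carrier (suc d) → Vec Carrier d
  divide a (c ∷ [])        = []
  divide a (c ∷ f@(_ ∷ _)) = eval f a ∷ divide a f

  eval-divide : ∀ {d} a (f : Vec Carrier (suc d)) x →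
                eval f x ≈ (x - a) * eval (divide a f) x + eval f a
  eval-divide a (c ∷ []) x =
    solve 3 (λ a c x → c :+ x :* :1 := (x :- a) :* :1 :+ (c :+ a :* :1)) refl a c x
  eval-divide a (c ∷ f@(_ ∷ _)) x = begin
    c + x * eval f x                      ≈⟨ +-congˡ (*-congˡ (eval-divide a f x)) ⟩
    c + x * ((x - a) * k + eval f a)      ≈⟨ solve 5 (λ a c x k h → c :+ x :* ((x :- a) :* k :+ h)
                                               := (x :- a) :* (h :+ x :* k) :+ (c :+ a :* h)) refl a c x k (eval f a) ⟩
    (x - a) * (eval f a + x * k) + (c + a * eval f a) ∎
    where k = eval (divide a f) x

  deriv-divide : ∀ {d} a (f : Vec Carrier (suc d)) x →
                 deriv f x ≈ eval (divide a f) x + (x - a) * deriv (divide a f) x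
  deriv-divide a (c ∷ []) x =
    solve 2 (λ a x → :1 :+ x :* :0 := :1 :+ (x :- a) :* :0) refl a x
  deriv-divide a (c ∷ f@(_ ∷ _)) x = begin
    eval f x + x * deriv f x
      ≈⟨ +-cong (eval-divide a f x) (*-congˡ (deriv-divide a f x)) ⟩
    ((x - a) * k + eval f a) + x * (k + (x - a) * k′)
      ≈⟨ solve 5 (λ a x k k′ h → ((x :- a) :* k :+ h) :+ x :* (k :+ (x :- a) :* k′)
           := (h :+ x :* k) :+ (x :- a) :* (k :+ x :* k′)) refl a x k k′ (eval f a) ⟩
    (eval f a + x * k) + (x - a) * (k + x * k′) ∎
    where
    k  = eval (divide a f) x
    k′ = deriv (divide a f) x

  -- The quotient `g` is specified only up to `Pointwise _≈_`, because a ring homomorphism commutes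
  -- with `divide` only up to `_≈_`.
  data Splits : ∀ {d} → Vec Carrier d → Vec Carrier d → Set where
    []   : Splits [] []
    root : ∀ {d a} {f : Vec Carrier (suc d)} {g as} →
           eval f a ≈ 0# → Pointwise _≈_ (divide a f) g → Splits g as → Splits f (a ∷ as)

  ∏ : ∀ {d} → Vec Carrier d → Carrier
  ∏ = Vec.foldr _ _*_ 1#

  differences : ∀ {d} → Carrier → Vec Carrier d → Vec Carrier d
  differences x = Vec.map (λ a → x - a)

  eval-root : ∀ {d a} {f : Vec Carrier (suc d)} {g} x → eval f a ≈ 0# → Pointwise _≈_ (divide a f) g →
              eval f x ≈ (x - a) * eval g x
  eval-root {a = a} {f} {g} x fa≈0 g≈ = begin
    eval f x                                  ≈⟨ eval-divide a f x ⟩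
    (x - a) * eval (divide a f) x + eval f a  ≈⟨ +-cong (*-congˡ (eval-cong x g≈)) fa≈0 ⟩
    (x - a) * eval g x + 0#                   ≈⟨ +-identityʳ _ ⟩
    (x - a) * eval g x                        ∎

  splits⇒eval≈∏ : ∀ {d} {f as : Vec Carrier d} → Splits f as → ∀ x → eval f x ≈ ∏ (differences x as)
  splits⇒eval≈∏ []                   x = refl
  splits⇒eval≈∏ (root fa≈0 g≈ split) x =
    trans (eval-root x fa≈0 g≈) (*-congˡ (splits⇒eval≈∏ split x))

  ∏-factor : ∀ {d} x (as : Vec Carrier d) j → ∃ λ u → ∏ (differences x as) ≈ (x - lookup as j) * u
  ∏-factor x (a ∷ as) zero    = _ , refl
  ∏-factor x (a ∷ as) (suc j) with ∏-factor x as j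
  ... | u , eq = (x - a) * u , (begin
    (x - a) * ∏ (differences x as)      ≈⟨ *-congˡ eq ⟩
    (x - a) * ((x - lookup as j) * u)   ≈⟨ solve 3 (λ p q r → p :* (q :* r) := q :* (p :* r)) refl _ _ _ ⟩
    (x - lookup as j) * ((x - a) * u)   ∎)

  splits⇒root : ∀ {d} {f as : Vec Carrier d} → Splits f as → ∀ i → eval f (lookup as i) ≈ 0#
  splits⇒root {f = f} {as} split i with ∏-factor (lookup as i) as i
  ... | u , eq = begin
    eval f (lookup as i)                   ≈⟨ splits⇒eval≈∏ split _ ⟩
    ∏ (differences (lookup as i) as)       ≈⟨ eq ⟩
    (lookup as i - lookup as i) * u        ≈⟨ *-congʳ (-‿inverseʳ _) ⟩
    0# * u                                 ≈⟨ zeroˡ u ⟩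
    0#                                     ∎

  -- f′(aᵢ) is the product of the aᵢ - aⱼ over j ≠ i.
  deriv-factor : ∀ {d} {f as : Vec Carrier d} → Splits f as → ∀ i j → i ≢ j →
                 ∃ λ u → deriv f (lookup as i) ≈ (lookup as i - lookup as j) * u
  deriv-factor []  ()
  deriv-factor (root _ _ _) zero zero i≢j = contradiction ≡.refl i≢j
  deriv-factor {as = a ∷ as} (root {f = f} {g} fa≈0 g≈ split) zero (suc j) _ with ∏-factor a as j
  ... | u , eq = u , (begin
    deriv f a                                           ≈⟨ deriv-divide a f a ⟩
    eval (divide a f) a + (a - a) * deriv (divide a f) a ≈⟨ solve 3 (λ e a k → e :+ (a :- a) :* k := e) refl _ _ _ ⟩
    eval (divide a f) a                                 ≈⟨ eval-cong a g≈ ⟩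
    eval g a                                            ≈⟨ splits⇒eval≈∏ split a ⟩
    ∏ (differences a as)                                ≈⟨ eq ⟩
    (a - lookup as j) * u                               ∎)
  deriv-factor {as = a ∷ as} (root {f = f} {g} fa≈0 g≈ split) (suc i) j i≢j = helper j i≢j
    where
    b = lookup as i
    f′b : deriv f b ≈ (b - a) * deriv g b
    f′b = begin
      deriv f b                                            ≈⟨ deriv-divide a f b ⟩
      eval (divide a f) b + (b - a) * deriv (divide a f) b ≈⟨ +-cong (eval-cong b g≈) (*-congˡ (deriv-cong b g≈)) ⟩
      eval g b + (b - a) * deriv g b                       ≈⟨ +-congʳ (splits⇒root split i) ⟩
      0# + (b - a) * deriv g b                             ≈⟨ +-identityˡ _ ⟩
      (b - a) * deriv g b                                  ∎
    helper : ∀ j → suc i ≢ j → ∃ λ u → deriv f b ≈ (b - lookup (a ∷ as) j) * u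
    helper zero    _   = deriv g b , f′b
    helper (suc j) i≢j with deriv-factor split i j (λ i≡j → i≢j (≡.cong suc i≡j))
    ... | u , eq = (b - a) * u , (begin
      deriv f b                           ≈⟨ f′b ⟩
      (b - a) * deriv g b                 ≈⟨ *-congˡ eq ⟩
      (b - a) * ((b - lookup as j) * u)   ≈⟨ solve 3 (λ p q r → p :* (q :* r) := q :* (p :* r)) refl _ _ _ ⟩
      (b - lookup as j) * ((b - a) * u)   ∎)

module FieldPolynomial (R : CommutativeRing 0ℓ 0ℓ) where
  open CommutativeRing R
  open IntegerCoefficients R using (solve; :0; :1; _:+_; _:*_; _:-_; :-_; _:=_)
  open MonicPolynomial R
  open Algebra.Properties.Semiring.Exp semiring using (_^_)
  open Algebra.Properties.Semiring.Mult semiring using (×-comm-*) renaming (_×_ to _·_)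
  open Relation.Binary.Reasoning.Setoid setoid

  -- X^(2+d) - X
  fieldPolynomial : ∀ d → Vec Carrier (2 ℕ.+ d)
  fieldPolynomial d = 0# ∷ - 1# ∷ replicate d 0#

  eval-monomial : ∀ d x → eval (replicate d 0#) x ≈ x ^ d
  eval-monomial zero    x = refl
  eval-monomial (suc d) x = trans (+-identityˡ _) (*-congˡ (eval-monomial d x))

  -- The extra factor `x` avoids the exponent `d - 1` and its special case at `d = 0`.
  deriv-monomial : ∀ d x → x * deriv (replicate d 0#) x ≈ d · (x ^ d)
  deriv-monomial zero    x = zeroʳ x
  deriv-monomial (suc d) x = begin
    x * (eval (replicate d 0#) x + x * deriv (replicate d 0#) x)
      ≈⟨ *-congˡ (+-cong (eval-monomial d x) (deriv-monomial d x)) ⟩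
    x * (x ^ d + d · (x ^ d))       ≈⟨ distribˡ _ _ _ ⟩
    x * x ^ d + x * (d · (x ^ d))   ≈⟨ +-congˡ (×-comm-* d x _) ⟩
    x * x ^ d + d · (x * x ^ d)     ∎

  eval-fieldPolynomial : ∀ d x → eval (fieldPolynomial d) x ≈ x ^ (2 ℕ.+ d) - x
  eval-fieldPolynomial d x = begin
    0# + x * (- 1# + x * eval (replicate d 0#) x)  ≈⟨ +-congˡ (*-congˡ (+-congˡ (*-congˡ (eval-monomial d x)))) ⟩
    0# + x * (- 1# + x * x ^ d)                    ≈⟨ solve 2 (λ x y → :0 :+ x :* (:- :1 :+ x :* y)
                                                        := x :* (x :* y) :- x) refl x (x ^ d) ⟩
    x * (x * x ^ d) - x                            ∎

  deriv-fieldPolynomial : ∀ d x → deriv (fieldPolynomial d) x ≈ (2 ℕ.+ d) · (x ^ (1 ℕ.+ d)) - 1#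
  deriv-fieldPolynomial d x = begin
    (- 1# + x * eval m x) + x * (eval m x + x * deriv m x)
      ≈⟨ +-cong (+-congˡ (*-congˡ (eval-monomial d x))) (*-congˡ (+-cong (eval-monomial d x) (deriv-monomial d x))) ⟩
    (- 1# + x * x ^ d) + x * (x ^ d + d · (x ^ d))
      ≈⟨ solve 3 (λ x y z → (:- :1 :+ x :* y) :+ x :* (y :+ z) := (x :* y :+ (x :* y :+ x :* z)) :- :1)
           refl x (x ^ d) (d · (x ^ d)) ⟩
    (x * x ^ d + (x * x ^ d + x * (d · (x ^ d)))) - 1#
      ≈⟨ +-congʳ (+-congˡ (+-congˡ (×-comm-* d x _))) ⟩
    (x * x ^ d + (x * x ^ d + d · (x * x ^ d))) - 1# ∎
    where m = replicate d 0#

module _ {R S : CommutativeRing 0ℓ 0ℓ} where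
  private
    module R = CommutativeRing R
    module S = CommutativeRing S
    module PR = MonicPolynomial R
    module PS = MonicPolynomial S

  module _ {φ : R.Carrier → S.Carrier} (isHom : IsRingHomomorphism R.rawRing S.rawRing φ) where
    open IsRingHomomorphism isHom

    eval-map : ∀ {d} (f : Vec R.Carrier d) x → PS.eval (Vec.map φ f) (φ x) S.≈ φ (PR.eval f x)
    eval-map []      x = S.sym 1#-homo
    eval-map (c ∷ f) x = S.sym (S.trans (+-homo c _)
      (S.+-congˡ (S.trans (*-homo x _) (S.*-congˡ (S.sym (eval-map f x))))))

    divide-map : ∀ {d} a (f : Vec R.Carrier (suc d)) →
                 Pointwise S._≈_ (PS.divide (φ a) (Vec.map φ f)) (Vec.map φ (PR.divide a f))
    divide-map a (c ∷ [])        = []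
    divide-map a (c ∷ f@(_ ∷ _)) = eval-map f a ∷ divide-map a f

-- Adjoining a root of a monic polynomial

Nontrivial : CommutativeRing 0ℓ 0ℓ → Set
Nontrivial R = ¬ 1# ≈ 0#
  where open CommutativeRing R

module ShiftAction (R : CommutativeRing 0ℓ 0ℓ) where
  open CommutativeRing R
  open IntegerCoefficients R using (solve; :0; _:+_; _:*_; _:-_; :-_; _:=_)
  open Relation.Binary.Reasoning.Setoid setoid

  -- The polynomial p₀ + p₁X + … acts on sequences with X as the shift.
  act : List Carrier → (ℕ → Carrier) → ℕ → Carrier
  act []      s n = 0#
  act (a ∷ p) s n = a * s n + act p s (suc n)

  add : List Carrier → List Carrier → List Carrier
  add []      q       = q
  add (a ∷ p) []      = a ∷ p
  add (a ∷ p) (b ∷ q) = a + b ∷ add p q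

  neg : List Carrier → List Carrier
  neg = List.map (λ a → - a)

  scale : Carrier → List Carrier → List Carrier
  scale a = List.map (a *_)

  mul : List Carrier → List Carrier → List Carrier
  mul []      q = []
  mul (a ∷ p) q = add (scale a q) (0# ∷ mul p q)

  act-add : ∀ p q s n → act (add p q) s n ≈ act p s n + act q s n
  act-add []      q       s n = sym (+-identityˡ _)
  act-add (a ∷ p) []      s n = sym (+-identityʳ _)
  act-add (a ∷ p) (b ∷ q) s n = begin
    (a + b) * s n + act (add p q) s (suc n)                    ≈⟨ +-congˡ (act-add p q s (suc n)) ⟩
    (a + b) * s n + (act p s (suc n) + act q s (suc n))
      ≈⟨ solve 5 (λ a b x y z → (a :+ b) :* x :+ (y :+ z) := (a :* x :+ y) :+ (b :* x :+ z)) refl a b _ _ _ ⟩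
    (a * s n + act p s (suc n)) + (b * s n + act q s (suc n))  ∎

  act-neg : ∀ p s n → act (neg p) s n ≈ - act p s n
  act-neg []      s n = solve 0 (:0 := :- :0) refl
  act-neg (a ∷ p) s n = begin
    - a * s n + act (neg p) s (suc n)  ≈⟨ +-congˡ (act-neg p s (suc n)) ⟩
    - a * s n - act p s (suc n)        ≈⟨ solve 3 (λ a x y → :- a :* x :- y := :- (a :* x :+ y)) refl a _ _ ⟩
    - (a * s n + act p s (suc n))      ∎

  act-scale : ∀ a p s n → act (scale a p) s n ≈ a * act p s n
  act-scale a []      s n = sym (zeroʳ a)
  act-scale a (b ∷ p) s n = begin
    a * b * s n + act (scale a p) s (suc n)  ≈⟨ +-congˡ (act-scale a p s (suc n)) ⟩
    a * b * s n + a * act p s (suc n)        ≈⟨ solve 4 (λ a b x y → a :* b :* x :+ a :* y := a :* (b :* x :+ y)) refl a b _ _ ⟩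
    a * (b * s n + act p s (suc n))          ∎

  act-mul : ∀ p q s n → act (mul p q) s n ≈ act p (act q s) n
  act-mul []      q s n = refl
  act-mul (a ∷ p) q s n = begin
    act (add (scale a q) (0# ∷ mul p q)) s n                     ≈⟨ act-add (scale a q) _ s n ⟩
    act (scale a q) s n + (0# * s n + act (mul p q) s (suc n))   ≈⟨ +-cong (act-scale a q s n) (+-cong (zeroˡ _) (act-mul p q s (suc n))) ⟩
    a * act q s n + (0# + act p (act q s) (suc n))               ≈⟨ +-congˡ (+-identityˡ _) ⟩
    a * act q s n + act p (act q s) (suc n)                      ∎

  act-cong : ∀ p {s t} → (∀ n → s n ≈ t n) → ∀ n → act p s n ≈ act p t n
  act-cong []      s≈t n = refl
  act-cong (a ∷ p) s≈t n = +-cong (*-congˡ (s≈t n)) (act-cong p s≈t (suc n))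

  act-linear : ∀ p a s t n → act p (λ m → a * s m + t m) n ≈ a * act p s n + act p t n
  act-linear []      a s t n = solve 1 (λ a → :0 := a :* :0 :+ :0) refl a
  act-linear (b ∷ p) a s t n = begin
    b * (a * s n + t n) + act p (λ m → a * s m + t m) (suc n)          ≈⟨ +-congˡ (act-linear p a s t (suc n)) ⟩
    b * (a * s n + t n) + (a * act p s (suc n) + act p t (suc n))
      ≈⟨ solve 6 (λ a b x y z w → b :* (a :* x :+ y) :+ (a :* z :+ w) := a :* (b :* x :+ z) :+ (b :* y :+ w)) refl a b _ _ _ _ ⟩
    a * (b * s n + act p s (suc n)) + (b * t n + act p t (suc n))      ∎

  act-shift : ∀ p s n → act p (s ∘ suc) n ≡ act p s (suc n)
  act-shift []      s n = ≡.refl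
  act-shift (a ∷ p) s n = ≡.cong (_ +_) (act-shift p s (suc n))

  act-zero : ∀ p n → act p (λ _ → 0#) n ≈ 0#
  act-zero []      n = refl
  act-zero (a ∷ p) n = trans (+-cong (zeroʳ a) (act-zero p (suc n))) (+-identityˡ _)

  -- Each action is linear and commutes with the shift, so induction on `p` suffices. This yields
  -- commutativity of `mul` modulo the annihilator without comparing coefficients of products.
  act-comm : ∀ p q s n → act p (act q s) n ≈ act q (act p s) n
  act-comm []      q s n = sym (act-zero q n)
  act-comm (a ∷ p) q s n = begin
    a * act q s n + act p (act q s) (suc n)     ≈⟨ +-congˡ (act-comm p q s (suc n)) ⟩
    a * act q s n + act q (act p s) (suc n)     ≡⟨ ≡.cong (_ +_) (act-shift q (act p s) n) ⟨
    a * act q s n + act q (act p s ∘ suc) n     ≈⟨ act-linear q a s (act p s ∘ suc) n ⟨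
    act q (act (a ∷ p) s) n                     ∎

  monicAct : ∀ {d} → Vec Carrier d → (ℕ → Carrier) → ℕ → Carrier
  monicAct []      s n = s n
  monicAct (c ∷ f) s n = c * s n + monicAct f s (suc n)

  monicAct-shift : ∀ {d} (f : Vec Carrier d) s n → monicAct f (s ∘ suc) n ≡ monicAct f s (suc n)
  monicAct-shift []      s n = ≡.refl
  monicAct-shift (c ∷ f) s n = ≡.cong (_ +_) (monicAct-shift f s (suc n))

-- R[X] modulo the annihilator of a sequence.
module Annihilator (R : CommutativeRing 0ℓ 0ℓ) (e : ℕ → CommutativeRing.Carrier R) where
  open CommutativeRing R
  open ShiftAction R
  open MonicPolynomial using (eval)
  open Relation.Binary.Reasoning.Setoid setoid

  -- The relation says that the difference annihilates `e`. Lists that differ by trailing zeros are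
  -- identified too, so no normal form is required.
  _∼_ : List Carrier → List Carrier → Set
  p ∼ q = ∀ n → act p e n ≈ act q e n

  one : List Carrier
  one = 1# ∷ []

  act-const : ∀ a s n → act (a ∷ []) s n ≈ a * s n
  act-const a s n = +-identityʳ _

  mul-comm : ∀ p q → mul p q ∼ mul q p
  mul-comm p q n = begin
    act (mul p q) e n    ≈⟨ act-mul p q e n ⟩
    act p (act q e) n    ≈⟨ act-comm p q e n ⟩
    act q (act p e) n    ≈⟨ act-mul q p e n ⟨
    act (mul q p) e n    ∎

  mul-congˡ : ∀ p {q r} → q ∼ r → mul p q ∼ mul p r
  mul-congˡ p {q} {r} q∼r n = begin
    act (mul p q) e n    ≈⟨ act-mul p q e n ⟩
    act p (act q e) n    ≈⟨ act-cong p q∼r n ⟩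
    act p (act r e) n    ≈⟨ act-mul p r e n ⟨
    act (mul p r) e n    ∎

  -- The right factor acts on `e` first, so it can be replaced directly by an equivalent one; the
  -- left factor is moved to the right by commutativity.
  mul-cong : ∀ {p q r t} → p ∼ q → r ∼ t → mul p r ∼ mul q t
  mul-cong {p} {q} {r} {t} p∼q r∼t n = begin
    act (mul p r) e n    ≈⟨ mul-congˡ p r∼t n ⟩
    act (mul p t) e n    ≈⟨ mul-comm p t n ⟩
    act (mul t p) e n    ≈⟨ mul-congˡ t p∼q n ⟩
    act (mul t q) e n    ≈⟨ mul-comm t q n ⟩
    act (mul q t) e n    ∎

  mul-assoc : ∀ p q r → mul (mul p q) r ∼ mul p (mul q r)
  mul-assoc p q r n = begin
    act (mul (mul p q) r) e n    ≈⟨ act-mul (mul p q) r e n ⟩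
    act (mul p q) (act r e) n    ≈⟨ act-mul p q (act r e) n ⟩
    act p (act q (act r e)) n    ≈⟨ act-cong p (act-mul q r e) n ⟨
    act p (act (mul q r) e) n    ≈⟨ act-mul p (mul q r) e n ⟨
    act (mul p (mul q r)) e n    ∎

  mul-identityˡ : ∀ p → mul one p ∼ p
  mul-identityˡ p n = begin
    act (mul one p) e n    ≈⟨ act-mul one p e n ⟩
    act one (act p e) n    ≈⟨ act-const 1# (act p e) n ⟩
    1# * act p e n         ≈⟨ *-identityˡ _ ⟩
    act p e n              ∎

  mul-distribʳ : ∀ p q r → mul (add q r) p ∼ add (mul q p) (mul r p)
  mul-distribʳ p q r n = begin
    act (mul (add q r) p) e n                  ≈⟨ act-mul (add q r) p e n ⟩
    act (add q r) (act p e) n                  ≈⟨ act-add q r (act p e) n ⟩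
    act q (act p e) n + act r (act p e) n      ≈⟨ +-cong (act-mul q p e n) (act-mul r p e n) ⟨
    act (mul q p) e n + act (mul r p) e n      ≈⟨ act-add (mul q p) (mul r p) e n ⟨
    act (add (mul q p) (mul r p)) e n          ∎

  add-cong : ∀ {p q r t} → p ∼ q → r ∼ t → add p r ∼ add q t
  add-cong {p} {q} {r} {t} p∼q r∼t n =
    trans (act-add p r e n) (trans (+-cong (p∼q n) (r∼t n)) (sym (act-add q t e n)))

  add-assoc : ∀ p q r → add (add p q) r ∼ add p (add q r)
  add-assoc p q r n = begin
    act (add (add p q) r) e n              ≈⟨ act-add (add p q) r e n ⟩
    act (add p q) e n + act r e n          ≈⟨ +-congʳ (act-add p q e n) ⟩
    act p e n + act q e n + act r e n      ≈⟨ +-assoc _ _ _ ⟩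
    act p e n + (act q e n + act r e n)    ≈⟨ +-congˡ (act-add q r e n) ⟨
    act p e n + act (add q r) e n          ≈⟨ act-add p (add q r) e n ⟨
    act (add p (add q r)) e n              ∎

  add-comm : ∀ p q → add p q ∼ add q p
  add-comm p q n = trans (act-add p q e n) (trans (+-comm _ _) (sym (act-add q p e n)))

  add-inverseˡ : ∀ p → add (neg p) p ∼ []
  add-inverseˡ p n = trans (act-add (neg p) p e n) (trans (+-congʳ (act-neg p e n)) (-‿inverseˡ _))

  neg-cong : ∀ {p q} → p ∼ q → neg p ∼ neg q
  neg-cong {p} {q} p∼q n = trans (act-neg p e n) (trans (-‿cong (p∼q n)) (sym (act-neg q e n)))

  ∼-trans : ∀ {p q r} → p ∼ q → q ∼ r → p ∼ r
  ∼-trans p∼q q∼r n = trans (p∼q n) (q∼r n)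

  ∼-isCommutativeRing : IsCommutativeRing _∼_ add mul neg [] one
  ∼-isCommutativeRing = record
    { isRing = record
      { +-isAbelianGroup = record
        { isGroup = record
          { isMonoid = record
            { isSemigroup = record
              { isMagma = record
                { isEquivalence = record
                  { refl  = λ n → refl
                  ; sym   = λ p∼q n → sym (p∼q n)
                  ; trans = λ {p} {q} {r} → ∼-trans {p} {q} {r}
                  }
                ; ∙-cong = λ {p} {q} {r} {t} → add-cong {p} {q} {r} {t}
                }
              ; assoc = add-assoc
              }
            ; identity = (λ p n → refl) , (λ p n → add-comm p [] n)
            }
          ; inverse = add-inverseˡ , (λ p n → trans (add-comm p (neg p) n) (add-inverseˡ p n))
          ; ⁻¹-cong = λ {p} {q} → neg-cong {p} {q}
          }
        ; comm = add-comm
        }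
      ; *-cong = λ {p} {q} {r} {t} → mul-cong {p} {q} {r} {t}
      ; *-assoc = mul-assoc
      ; *-identity = mul-identityˡ , (λ p n → trans (mul-comm p one n) (mul-identityˡ p n))
      ; distrib = (λ p q r n → trans (mul-comm p (add q r) n) (trans (mul-distribʳ p q r n)
                    (add-cong {mul q p} {mul p q} {mul r p} {mul p r} (mul-comm q p) (mul-comm r p) n)))
                , mul-distribʳ
      }
    ; *-comm = mul-comm
    }

  extension : CommutativeRing 0ℓ 0ℓ
  extension = record { isCommutativeRing = ∼-isCommutativeRing }

  X : List Carrier
  X = 0# ∷ 1# ∷ []

  const : Carrier → List Carrier
  const a = a ∷ []

  const-isHom : IsRingHomomorphism rawRing (CommutativeRing.rawRing extension) const
  const-isHom = record
    { isSemiringHomomorphism = record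
      { isNearSemiringHomomorphism = record
        { +-isMonoidHomomorphism = record
          { isMagmaHomomorphism = record
            { isRelHomomorphism = record { cong = λ a≈b n → +-congʳ (*-congʳ a≈b) }
            ; homo = λ a b n → refl
            }
          ; ε-homo = λ n → trans (act-const 0# e n) (zeroˡ _)
          }
        ; *-homo = λ a b n → sym (begin
            act (mul (const a) (const b)) e n  ≈⟨ act-mul (const a) (const b) e n ⟩
            act (const a) (act (const b) e) n  ≈⟨ act-const a (act (const b) e) n ⟩
            a * act (const b) e n              ≈⟨ *-congˡ (act-const b e n) ⟩
            a * (b * e n)                      ≈⟨ *-assoc _ _ _ ⟨
            a * b * e n                        ≈⟨ act-const (a * b) e n ⟨
            act (const (a * b)) e n            ∎)
        }
      ; 1#-homo = λ n → refl
      }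
    ; -‿homo = λ a n → refl
    }

  act-X : ∀ s n → act X s n ≈ s (suc n)
  act-X s n = begin
    0# * s n + (1# * s (suc n) + 0#)  ≈⟨ +-cong (zeroˡ _) (+-identityʳ _) ⟩
    0# + 1# * s (suc n)               ≈⟨ +-identityˡ _ ⟩
    1# * s (suc n)                    ≈⟨ *-identityˡ _ ⟩
    s (suc n)                         ∎

  -- Reduces the claim that `X` is a root of `f` in `extension` to the claim that `e` satisfies the
  -- recurrence given by `f`.
  act-eval-X : ∀ {d} (f : Vec Carrier d) s n → act (eval extension (Vec.map const f) X) s n ≈ monicAct f s n
  act-eval-X []      s n = trans (act-const 1# s n) (*-identityˡ _)
  act-eval-X (c ∷ f) s n = begin
    act (add (const c) (mul X fX)) s n                ≈⟨ act-add (const c) (mul X fX) s n ⟩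
    act (const c) s n + act (mul X fX) s n            ≈⟨ +-cong (act-const c s n) (act-mul X fX s n) ⟩
    c * s n + act X (act fX s) n                      ≈⟨ +-congˡ (act-X (act fX s) n) ⟩
    c * s n + act fX s (suc n)                        ≈⟨ +-congˡ (act-eval-X f s (suc n)) ⟩
    c * s n + monicAct f s (suc n)                    ∎
    where fX = eval extension (Vec.map const f) X

module LinearRecurrence (R : CommutativeRing 0ℓ 0ℓ) {d : ℕ} (f : Vec (CommutativeRing.Carrier R) (suc d)) where
  open CommutativeRing R hiding (zero)
  open ShiftAction R
  open Relation.Binary.Reasoning.Setoid setoid

  dot : ∀ {k} → Vec Carrier k → Vec Carrier k → Carrier
  dot []      []      = 0#
  dot (c ∷ g) (x ∷ v) = c * x + dot g v

  -- A state is a window of `suc d` consecutive entries. Sliding it by one drops the head, and the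
  -- recurrence with the implicit leading coefficient 1 forces the new last entry.
  next : Vec Carrier (suc d) → Vec Carrier (suc d)
  next v = Vec.tail v ∷ʳ (- dot f v)

  sequence : Vec Carrier (suc d) → ℕ → Carrier
  sequence v zero    = Vec.head v
  sequence v (suc n) = sequence (next v) n

  lookup-∷ʳ-inject₁ : ∀ {k} (v : Vec Carrier k) y i → lookup (v ∷ʳ y) (inject₁ i) ≡ lookup v i
  lookup-∷ʳ-inject₁ (x ∷ v) y zero    = ≡.refl
  lookup-∷ʳ-inject₁ (x ∷ v) y (suc i) = lookup-∷ʳ-inject₁ v y i

  lookup-∷ʳ-fromℕ : ∀ {k} (v : Vec Carrier k) y → lookup (v ∷ʳ y) (fromℕ k) ≡ y
  lookup-∷ʳ-fromℕ []      y = ≡.refl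
  lookup-∷ʳ-fromℕ (x ∷ v) y = lookup-∷ʳ-fromℕ v y

  sequence-initial : ∀ n v (i : Fin (suc d)) → toℕ i ≡ n → sequence v n ≡ lookup v i
  sequence-initial zero    (x ∷ v) zero    _  = ≡.refl
  sequence-initial (suc n) (x ∷ v) (suc i) eq = ≡.trans
    (sequence-initial n (next (x ∷ v)) (inject₁ i) (≡.trans (Fin.toℕ-inject₁ i) (ℕ.suc-injective eq)))
    (lookup-∷ʳ-inject₁ v (- dot f (x ∷ v)) i)

  sequence-next : ∀ v → sequence v (suc d) ≡ - dot f v
  sequence-next v = ≡.trans (sequence-initial d (next v) (fromℕ d) (Fin.toℕ-fromℕ d))
    (lookup-∷ʳ-fromℕ (Vec.tail v) (- dot f v))

  monicAct-dot : ∀ {k} (g v : Vec Carrier k) s n → (∀ i → s (toℕ i ℕ.+ n) ≡ lookup v i) →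
                 monicAct g s n ≈ dot g v + s (k ℕ.+ n)
  monicAct-dot []      []      s n s≡v = sym (+-identityˡ _)
  monicAct-dot {suc k} (c ∷ g) (x ∷ v) s n s≡v = begin
    c * s n + monicAct g s (suc n)           ≈⟨ +-cong (*-congˡ (reflexive (s≡v zero))) (monicAct-dot g v s (suc n) s≡v′) ⟩
    c * x + (dot g v + s (k ℕ.+ suc n))      ≡⟨ ≡.cong (λ m → c * x + (dot g v + s m)) (ℕ.+-suc k n) ⟩
    c * x + (dot g v + s (suc (k ℕ.+ n)))    ≈⟨ +-assoc _ _ _ ⟨
    c * x + dot g v + s (suc k ℕ.+ n)        ∎
    where
    s≡v′ : ∀ i → s (toℕ i ℕ.+ suc n) ≡ lookup v i
    s≡v′ i = ≡.trans (≡.cong s (ℕ.+-suc (toℕ i) n)) (s≡v (suc i))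

  -- At index 0 the new entry cancels the contribution of the window by construction. Every later
  -- index is index 0 for a later window.
  sequence-annihilated : ∀ v n → monicAct f (sequence v) n ≈ 0#
  sequence-annihilated v zero = begin
    monicAct f (sequence v) 0                       ≈⟨ monicAct-dot f v (sequence v) 0
                                                         (λ i → sequence-initial _ v i (≡.sym (ℕ.+-identityʳ _))) ⟩
    dot f v + sequence v (suc d ℕ.+ 0)              ≡⟨ ≡.cong (λ m → dot f v + sequence v m) (ℕ.+-identityʳ (suc d)) ⟩
    dot f v + sequence v (suc d)                    ≡⟨ ≡.cong (dot f v +_) (sequence-next v) ⟩
    dot f v - dot f v                               ≈⟨ -‿inverseʳ _ ⟩
    0#                                              ∎
  sequence-annihilated v (suc n) = begin
    monicAct f (sequence v) (suc n)                 ≡⟨ monicAct-shift f (sequence v) n ⟨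
    monicAct f (sequence (next v)) n                ≈⟨ sequence-annihilated (next v) n ⟩
    0#                                              ∎

record RootExtension (R : CommutativeRing 0ℓ 0ℓ) {d : ℕ} (f : Vec (CommutativeRing.Carrier R) d) : Set₁ where
  private module R = CommutativeRing R
  field
    S          : CommutativeRing 0ℓ 0ℓ
    nontrivial : Nontrivial S
  open CommutativeRing S public
  field
    φ          : R.Carrier → Carrier
    isHom      : IsRingHomomorphism R.rawRing rawRing φ
    a          : Carrier
    isRoot     : MonicPolynomial.eval S (Vec.map φ f) a ≈ 0#

adjoinRoot : ∀ R → Nontrivial R → ∀ {d} (f : Vec (CommutativeRing.Carrier R) (suc d)) → RootExtension R f
adjoinRoot R 1≉0 f = record
  { S          = extension
  -- The sequence begins with `1#`, so comparing the two actions at index 0 gives `1# ≈ 0#` already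
  -- in `R`.
  ; nontrivial = λ 1∼0 → 1≉0 (trans (sym (trans (+-identityʳ _) (*-identityˡ 1#))) (1∼0 0))
  ; φ          = const
  ; isHom      = const-isHom
  ; a          = X
  ; isRoot     = λ n → trans (act-eval-X f _ n) (sequence-annihilated (1# ∷ replicate _ 0#) n)
  }
  where
  open CommutativeRing R
  open LinearRecurrence R f
  open Annihilator R (sequence (1# ∷ replicate _ 0#))

-- Splitting a monic polynomial completely

record SplittingExtension (R : CommutativeRing 0ℓ 0ℓ) {d : ℕ} (f : Vec (CommutativeRing.Carrier R) d) : Set₁ where
  private module R = CommutativeRing R
  field
    S          : CommutativeRing 0ℓ 0ℓ
    nontrivial : Nontrivial S
  open CommutativeRing S public
  field
    φ          : R.Carrier → Carrier
    isHom      : IsRingHomomorphism R.rawRing rawRing φ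
    roots      : Vec Carrier d
    splits     : MonicPolynomial.Splits S (Vec.map φ f) roots

-- Adjoin one root, divide it off, and continue with the quotient over the larger ring. The degree
-- drops each time, and no irreducible factor has to be found.
split : ∀ R → Nontrivial R → ∀ {d} (f : Vec (CommutativeRing.Carrier R) d) → SplittingExtension R f
split R 1≉0 [] = record
  { S          = R
  ; nontrivial = 1≉0
  ; φ          = id
  ; isHom      = Identity.isRingHomomorphism rawRing refl
  ; roots      = []
  ; splits     = MonicPolynomial.[]
  }
  where open CommutativeRing R
split R 1≉0 f@(_ ∷ _) = record
  { S          = E₂.S
  ; nontrivial = E₂.nontrivial
  ; φ          = E₂.φ ∘ E₁.φ
  ; isHom      = Composition.isRingHomomorphism E₂.trans E₁.isHom E₂.isHom
  ; roots      = E₂.φ E₁.a ∷ E₂.roots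
  ; splits     = ≡.subst (λ g → MonicPolynomial.Splits E₂.S g (E₂.φ E₁.a ∷ E₂.roots)) (≡.sym (map-∘ E₂.φ E₁.φ f))
      (MonicPolynomial.root
        (E₂.trans (eval-map E₂.isHom (Vec.map E₁.φ f) E₁.a) (E₂.trans (H₂.⟦⟧-cong E₁.isRoot) H₂.0#-homo))
        (divide-map E₂.isHom E₁.a (Vec.map E₁.φ f))
        E₂.splits)
  }
  where
  module E₁ = RootExtension (adjoinRoot R 1≉0 f)
  module E₂ = SplittingExtension (split E₁.S E₁.nontrivial (MonicPolynomial.divide E₁.S E₁.a (Vec.map E₁.φ f)))
  module H₂ = IsRingHomomorphism E₂.isHom

-- Binomial coefficients modulo a prime and the Frobenius map

prime∤! : ∀ {p} → Prime p → ∀ {k} → k < p → ¬ p ∣ k !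
prime∤! {p} pr {zero}  k<p p∣1 = ℕ.nonTrivial⇒≢1 {{prime⇒nonTrivial pr}} (∣1⇒≡1 p∣1)
prime∤! {p} pr {suc k} k<p p∣k! with euclidsLemma (suc k) (k !) pr p∣k!
... | inj₁ p∣1+k = >⇒∤ k<p p∣1+k
... | inj₂ p∣k!′ = prime∤! pr (ℕ.<-trans (ℕ.n<1+n k) k<p) p∣k!′

-- The prime divides `p ! = (p C k) * (k ! * (p - k) !)` but neither of the two factorials on the
-- right, whose factors are all below `p`.
prime∣C : ∀ {p} → Prime p → ∀ {k} → 0 < k → k < p → p ∣ p C k
prime∣C {p} pr {k} 0<k k<p = case
  where
  instance _ = k ℕ.!* (p ℕ.∸ k) !≢0
  k≤p = ℕ.<⇒≤ k<p

  C*k![p-k]!≡p! : (p C k) ℕ.* (k ! ℕ.* (p ℕ.∸ k) !) ≡ p !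
  C*k![p-k]!≡p! = ≡.trans (≡.cong (ℕ._* (k ! ℕ.* (p ℕ.∸ k) !)) (nCk≡n!/k![n-k]! k≤p)) (m/n*n≡m (k![n∸k]!∣n! k≤p))

  p∣p! : ∀ {p} → .{{ℕ.NonZero p}} → p ∣ p !
  p∣p! {suc p} = m∣m*n (p !)

  case : p ∣ p C k
  case with euclidsLemma (p C k) _ pr (≡.subst (p ∣_) (≡.sym C*k![p-k]!≡p!) (p∣p! {{prime⇒nonZero pr}}))
  ... | inj₁ p∣C = p∣C
  ... | inj₂ p∣k!* with euclidsLemma (k !) _ pr p∣k!*
  ...   | inj₁ p∣k!     = contradiction p∣k! (prime∤! pr k<p)
  ...   | inj₂ p∣[p-k]! = contradiction p∣[p-k]! (prime∤! pr (ℕ.∸-monoʳ-< {p} 0<k k≤p))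

module Frobenius (R : CommutativeRing 0ℓ 0ℓ) where
  open CommutativeRing R hiding (zero)
  open IntegerCoefficients R using (solve; _:+_; _:*_; _:-_; _:=_)
  open Algebra.Properties.CommutativeSemiring.Exp commutativeSemiring
  open Algebra.Properties.CommutativeSemiring.Binomial commutativeSemiring
  open Algebra.Properties.Semiring.Mult semiring using (×-congˡ; ×-assocˡ; ×-homo-1) renaming (_×_ to _·_)
  open Algebra.Properties.Semiring.Sum semiring using (sum; sum-cong-≋; sum-init-last; sum-replicate-zero)
  open Relation.Binary.Reasoning.Setoid setoid

  HasCharacteristic : ℕ → Set
  HasCharacteristic p = ∀ x → p · x ≈ 0#

  module _ {p : ℕ} (pr : Prime p) (char : HasCharacteristic p) where

    multiple·≈0 : ∀ {n} x → p ∣ n → n · x ≈ 0#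
    multiple·≈0 x (divides q ≡.refl) = begin
      (q ℕ.* p) · x  ≈⟨ ×-congˡ (ℕ.*-comm q p) ⟩
      (p ℕ.* q) · x  ≈⟨ ×-assocˡ x p q ⟨
      p · (q · x)    ≈⟨ char _ ⟩
      0#             ∎

    -- Only the outer two terms of the binomial expansion survive, since `p` divides all inner
    -- coefficients.
    frobenius-+ : ∀ x y → (x + y) ^ p ≈ x ^ p + y ^ p
    frobenius-+ x y = helper p ≡.refl
      where
      -- Replacing the parameter `p` by a variable allows the match on `suc n`, after which the sum
      -- can be cut at both ends.
      helper : ∀ n → n ≡ p → (x + y) ^ n ≈ x ^ n + y ^ n
      helper zero    ≡.refl = contradiction pr λ ()
      helper (suc n) ≡.refl = begin
        (x + y) ^ suc n                   ≈⟨ theorem (suc n) x y ⟩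
        t zero + sum (t ∘ suc)            ≈⟨ +-congˡ (sum-init-last (t ∘ suc)) ⟩
        t zero + (sum (t ∘ suc ∘ inject₁) + t (fromℕ (suc n)))
          ≈⟨ +-cong first (+-cong (trans (sum-cong-≋ middle) (sum-replicate-zero n)) last) ⟩
        y ^ suc n + (0# + x ^ suc n)      ≈⟨ +-congˡ (+-identityˡ _) ⟩
        y ^ suc n + x ^ suc n             ≈⟨ +-comm _ _ ⟩
        x ^ suc n + y ^ suc n             ∎
        where
        t = binomialTerm x y (suc n)
        first : t zero ≈ y ^ suc n
        first = trans (×-homo-1 _) (*-identityˡ _)
        last : t (fromℕ (suc n)) ≈ x ^ suc n
        last = begin
          (suc n C toℕ (fromℕ (suc n))) · (x ^ toℕ (fromℕ (suc n)) * y ^ (suc n ℕ.∸ toℕ (fromℕ (suc n))))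
            ≡⟨ ≡.cong (λ k → (suc n C k) · (x ^ k * y ^ (suc n ℕ.∸ k))) (Fin.toℕ-fromℕ (suc n)) ⟩
          (suc n C suc n) · (x ^ suc n * y ^ (n ℕ.∸ n))
            ≡⟨ ≡.cong₂ (λ c k → c · (x ^ suc n * y ^ k)) (nCn≡1 (suc n)) (ℕ.n∸n≡0 n) ⟩
          1 · (x ^ suc n * 1#)    ≈⟨ ×-homo-1 _ ⟩
          x ^ suc n * 1#          ≈⟨ *-identityʳ _ ⟩
          x ^ suc n               ∎
        middle : ∀ i → t (suc (inject₁ i)) ≈ 0#
        middle i = multiple·≈0 _ (prime∣C pr z<s (s<s (≡.subst (_< n) (≡.sym (Fin.toℕ-inject₁ i)) (Fin.toℕ<n i))))

    frobenius^-+ : ∀ k x y → (x + y) ^ (p ℕ.^ k) ≈ x ^ (p ℕ.^ k) + y ^ (p ℕ.^ k)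
    frobenius^-+ zero    x y = trans (*-identityʳ _) (sym (+-cong (*-identityʳ _) (*-identityʳ _)))
    frobenius^-+ (suc k) x y = begin
      (x + y) ^ (p ℕ.* q)              ≈⟨ ^-assocʳ (x + y) p q ⟨
      ((x + y) ^ p) ^ q                ≈⟨ ^-congˡ q (frobenius-+ x y) ⟩
      (x ^ p + y ^ p) ^ q              ≈⟨ frobenius^-+ k (x ^ p) (y ^ p) ⟩
      (x ^ p) ^ q + (y ^ p) ^ q        ≈⟨ +-cong (^-assocʳ x p q) (^-assocʳ y p q) ⟩
      x ^ (p ℕ.* q) + y ^ (p ℕ.* q)    ∎
      where q = p ℕ.^ k

    -- Additivity is applied to `(x - y) + y`, so the sign of a power of `- 1#` never has to be
    -- determined.
    fixed-sub : ∀ k {x y} → x ^ (p ℕ.^ k) ≈ x → y ^ (p ℕ.^ k) ≈ y → (x - y) ^ (p ℕ.^ k) ≈ x - y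
    fixed-sub k {x} {y} xq≈x yq≈y = begin
      (x - y) ^ q                  ≈⟨ solve 2 (λ a b → a := a :+ b :- b) refl _ (y ^ q) ⟩
      (x - y) ^ q + y ^ q - y ^ q  ≈⟨ +-congʳ (frobenius^-+ k (x - y) y) ⟨
      (x - y + y) ^ q - y ^ q      ≈⟨ +-congʳ (^-congˡ q (solve 2 (λ x y → x :- y :+ y := x) refl x y)) ⟩
      x ^ q - y ^ q                ≈⟨ +-cong xq≈x (-‿cong yq≈y) ⟩
      x - y                        ∎
      where q = p ℕ.^ k

  fixed-mul : ∀ q {x y} → x ^ q ≈ x → y ^ q ≈ y → (x * y) ^ q ≈ x * y
  fixed-mul q {x} {y} xq≈x yq≈y = trans (^-distrib-* x y q) (*-cong xq≈x yq≈y)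

  -- Both `u` and `u ^ q` are inverse to `x ≈ x ^ q`, and inverses are unique.
  fixed-inverse : ∀ q {x u} → x ^ q ≈ x → x * u ≈ 1# → u ^ q ≈ u
  fixed-inverse q {x} {u} xq≈x xu≈1 = begin
    u ^ q                ≈⟨ *-identityʳ _ ⟨
    u ^ q * 1#           ≈⟨ *-congˡ xu≈1 ⟨
    u ^ q * (x * u)      ≈⟨ *-congˡ (*-congʳ xq≈x) ⟨
    u ^ q * (x ^ q * u)  ≈⟨ solve 3 (λ a b c → a :* (b :* c) := b :* a :* c) refl _ _ _ ⟩
    x ^ q * u ^ q * u    ≈⟨ *-congʳ (^-distrib-* x u q) ⟨
    (x * u) ^ q * u      ≈⟨ *-congʳ (^-congˡ q xu≈1) ⟩
    1# ^ q * u           ≈⟨ *-congʳ (1^ q) ⟩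
    1# * u               ≈⟨ *-identityˡ u ⟩
    u                    ∎
    where
    1^ : ∀ n → 1# ^ n ≈ 1#
    1^ zero    = refl
    1^ (suc n) = trans (*-identityˡ _) (1^ n)

-- Ideals, quotient rings and the integers modulo a prime

record Ideal (R : CommutativeRing 0ℓ 0ℓ) : Set₁ where
  open CommutativeRing R
  field
    Member   : Carrier → Set
    resp     : ∀ {x y} → x ≈ y → Member x → Member y
    0-member : Member 0#
    +-closed : ∀ {x y} → Member x → Member y → Member (x + y)
    *-closed : ∀ a {x} → Member x → Member (a * x)

  Proper : Set
  Proper = ¬ Member 1#

module _ {R : CommutativeRing 0ℓ 0ℓ} where
  open CommutativeRing R
  open IntegerCoefficients R using (solve; :0; :1; _:+_; _:*_; _:-_; :-_; _:=_)

  zeroIdeal : Ideal R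
  zeroIdeal = record
    { Member   = _≈ 0#
    ; resp     = λ x≈y x≈0 → trans (sym x≈y) x≈0
    ; 0-member = refl
    ; +-closed = λ x≈0 y≈0 → trans (+-cong x≈0 y≈0) (+-identityˡ 0#)
    ; *-closed = λ a x≈0 → trans (*-congˡ x≈0) (zeroʳ a)
    }

  -- This is `I + (a)`, with the coefficient of `a` as the witness of membership.
  adjoin : Ideal R → Carrier → Ideal R
  adjoin I a = record
    { Member   = λ x → ∃ λ c → Member (x - c * a)
    ; resp     = λ x≈y (c , x∈I) → c , resp (+-congʳ x≈y) x∈I
    ; 0-member = 0# , resp (solve 1 (λ a → :0 := :0 :- :0 :* a) refl a) 0-member
    ; +-closed = λ {x} {y} (c , x∈I) (d , y∈I) → c + d ,
        resp (solve 5 (λ x y c d a → x :- c :* a :+ (y :- d :* a) := x :+ y :- (c :+ d) :* a) refl x y c d a) (+-closed x∈I y∈I)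
    ; *-closed = λ b {x} (c , x∈I) → b * c ,
        resp (solve 4 (λ b x c a → b :* (x :- c :* a) := b :* x :- b :* c :* a) refl b x c a) (*-closed b x∈I)
    }
    where open Ideal I

  ⊆-adjoin : ∀ I a {x} → Ideal.Member I x → Ideal.Member (adjoin I a) x
  ⊆-adjoin I a {x} x∈I = 0# , Ideal.resp I (solve 2 (λ x a → x := x :- :0 :* a) refl x a) x∈I

  ∈-adjoin : ∀ I a → Ideal.Member (adjoin I a) a
  ∈-adjoin I a = 1# , Ideal.resp I (solve 1 (λ a → :0 := a :- :1 :* a) refl a) (Ideal.0-member I)

  module _ (I : Ideal R) where
    open Ideal I

    _≋_ : Carrier → Carrier → Set
    x ≋ y = Member (x - y)

    ≈⇒≋ : ∀ {x y} → x ≈ y → x ≋ y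
    ≈⇒≋ {x} {y} x≈y = resp (sym (trans (+-congʳ x≈y) (-‿inverseʳ y))) 0-member

    -- Carrier and operations are kept and only equality becomes coarser, so the ring laws pass over
    -- through `≈⇒≋`; the congruences are where closure of `I` enters.
    quotient : CommutativeRing 0ℓ 0ℓ
    quotient = record
      { _≈_ = _≋_
      ; _+_ = _+_
      ; _*_ = _*_
      ; -_  = λ x → - x
      ; 0#  = 0#
      ; 1#  = 1#
      ; isCommutativeRing = record
        { isRing = record
          { +-isAbelianGroup = record
            { isGroup = record
              { isMonoid = record
                { isSemigroup = record
                  { isMagma = record
                    { isEquivalence = record
                      { refl  = ≈⇒≋ refl
                      ; sym   = λ {x} {y} x≋y →
                          resp (solve 2 (λ x y → (:- :1) :* (x :- y) := y :- x) refl x y) (*-closed (- 1#) x≋y)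
                      ; trans = λ {x} {y} {z} x≋y y≋z →
                          resp (solve 3 (λ x y z → (x :- y) :+ (y :- z) := x :- z) refl x y z) (+-closed x≋y y≋z)
                      }
                    ; ∙-cong = λ {x} {y} {u} {v} x≋y u≋v →
                        resp (solve 4 (λ x y u v → (x :- y) :+ (u :- v) := (x :+ u) :- (y :+ v)) refl x y u v)
                          (+-closed x≋y u≋v)
                    }
                  ; assoc = λ x y z → ≈⇒≋ (+-assoc x y z)
                  }
                ; identity = (λ x → ≈⇒≋ (+-identityˡ x)) , (λ x → ≈⇒≋ (+-identityʳ x))
                }
              ; inverse = (λ x → ≈⇒≋ (-‿inverseˡ x)) , (λ x → ≈⇒≋ (-‿inverseʳ x))
              ; ⁻¹-cong = λ {x} {y} x≋y →
                  resp (solve 2 (λ x y → (:- :1) :* (x :- y) := (:- x) :- (:- y)) refl x y) (*-closed (- 1#) x≋y)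
              }
            ; comm = λ x y → ≈⇒≋ (+-comm x y)
            }
          ; *-cong = λ {x} {y} {u} {v} x≋y u≋v →
              resp (solve 4 (λ x y u v → u :* (x :- y) :+ y :* (u :- v) := x :* u :- y :* v) refl x y u v)
                (+-closed (*-closed u x≋y) (*-closed y u≋v))
          ; *-assoc = λ x y z → ≈⇒≋ (*-assoc x y z)
          ; *-identity = (λ x → ≈⇒≋ (*-identityˡ x)) , (λ x → ≈⇒≋ (*-identityʳ x))
          ; distrib = (λ x y z → ≈⇒≋ (distribˡ x y z)) , (λ x y z → ≈⇒≋ (distribʳ x y z))
          }
        ; *-comm = λ x y → ≈⇒≋ (*-comm x y)
        }
      }

    quotient-nontrivial : Proper → Nontrivial quotient
    quotient-nontrivial proper 1≋0 = proper (resp (solve 0 (:1 :- :0 := :1) refl) 1≋0)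

  ≋0⇐∈ : ∀ (I : Ideal R) {x} → Ideal.Member I x → CommutativeRing._≈_ (quotient I) x 0#
  ≋0⇐∈ I {x} = Ideal.resp I (solve 1 (λ x → x := x :- :0) refl x)

module _ (p : ℕ) where
  ℤ-zero : Ideal ℤ.+-*-commutativeRing
  ℤ-zero = zeroIdeal

  pℤ : Ideal ℤ.+-*-commutativeRing
  pℤ = adjoin ℤ-zero (ℤ.+ p)

  ℤ/ : CommutativeRing 0ℓ 0ℓ
  ℤ/ = quotient pℤ

  open CommutativeRing ℤ/
  open Algebra.Properties.Semiring.Mult semiring using () renaming (_×_ to _·_)

  -- If `1 = c * p` in ℤ, then absolute values show that `p` divides 1.
  ℤ/-nontrivial : Prime p → Nontrivial ℤ/
  ℤ/-nontrivial pr = quotient-nontrivial pℤ λ (c , 1-cp≡0) →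
    let 1≡cp = ℤ.i-j≡0⇒i≡j (ℤ.+ 1) (c ℤ.* ℤ.+ p) 1-cp≡0
        1≡∣c∣p = ≡.trans (≡.cong ℤ.∣_∣ 1≡cp) (ℤ.abs-* c (ℤ.+ p))
    in ℕ.nonTrivial⇒≢1 {{prime⇒nonTrivial pr}} (∣1⇒≡1 (divides ℤ.∣ c ∣ 1≡∣c∣p))

  ·1≡+ : ∀ n → n · 1# ≡ ℤ.+ n
  ·1≡+ zero    = ≡.refl
  ·1≡+ (suc n) = ≡.cong (ℤ._+_ (ℤ.+ 1)) (·1≡+ n)

  ℤ/-characteristic : p · 1# ≈ 0#
  ℤ/-characteristic = ≡.subst (_≈ 0#) (≡.sym (·1≡+ p)) (≋0⇐∈ pℤ {ℤ.+ p} (∈-adjoin ℤ-zero (ℤ.+ p)))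

-- The roots of X^q - X in characteristic p

-- S may have zero divisors, so the roots need not exhaust the solutions of x ^ q ≈ x.
record FrobeniusRoots (q : ℕ) : Set₁ where
  field
    S          : CommutativeRing 0ℓ 0ℓ
    nontrivial : Nontrivial S
  open CommutativeRing S public hiding (zero)
  open Algebra.Properties.Semiring.Exp semiring public using (_^_)
  open MonicPolynomial S public using (∏; differences)

  Fixed : Carrier → Set
  Fixed x = x ^ q ≈ x

  field
    roots         : Vec Carrier q
    roots-fixed   : ∀ i → Fixed (lookup roots i)
    fixed⇒∏≈0     : ∀ {x} → Fixed x → ∏ (differences x roots) ≈ 0#
    invertible    : ∀ {i j} → i ≢ j → ∃ λ u → (lookup roots i - lookup roots j) * u ≈ 1#
    fixed-sub     : ∀ {x y} → Fixed x → Fixed y → Fixed (x - y)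

splitting⇒frobeniusRoots : ∀ {p k d} → Prime p → k ≥ 1 → 2 ℕ.+ d ≡ p ℕ.^ k →
                           SplittingExtension (ℤ/ p) (FieldPolynomial.fieldPolynomial (ℤ/ p) d) →
                           FrobeniusRoots (2 ℕ.+ d)
splitting⇒frobeniusRoots {p} {suc k} {d} pr (s≤s _) q≡p^k E = record
  { S           = E.S
  ; nontrivial  = E.nontrivial
  ; roots       = E.roots
  ; roots-fixed = λ i → x∙y⁻¹≈ε⇒x≈y _ _ (trans (sym (eval-f _)) (splits⇒root E.splits i))
  ; fixed⇒∏≈0   = λ {x} xq≈x → trans (sym (splits⇒eval≈∏ E.splits x)) (trans (eval-f x) (x≈y⇒x∙y⁻¹≈ε xq≈x))
  ; invertible  = invertible
  ; fixed-sub   = fixed-sub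
  }
  where
  module Z = CommutativeRing (ℤ/ p)
  f = FieldPolynomial.fieldPolynomial (ℤ/ p) d
  module E = SplittingExtension E
  module H = IsRingHomomorphism E.isHom
  open CommutativeRing E.S hiding (zero)
  open Algebra.Properties.Ring ring
  open Algebra.Properties.Semiring.Exp semiring using (_^_)
  open Algebra.Properties.Semiring.Mult semiring using (×-assoc-*; ×-congʳ; ×-assocˡ; ×-congˡ) renaming (_×_ to _·_)
  open Algebra.Properties.Semiring.Mult Z.semiring using () renaming (_×_ to _·′_)
  open MonicPolynomial E.S
  open FieldPolynomial E.S
  open IntegerCoefficients E.S using (solve; _:*_; :-_; _:=_)
  open Relation.Binary.Reasoning.Setoid setoid
  q = 2 ℕ.+ d

  φ-·1 : ∀ n → E.φ (n ·′ Z.1#) ≈ n · 1#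
  φ-·1 zero    = H.0#-homo
  φ-·1 (suc n) = trans (H.+-homo _ _) (+-cong H.1#-homo (φ-·1 n))

  characteristic : ∀ x → p · x ≈ 0#
  characteristic x = begin
    p · x                      ≈⟨ ×-congʳ p (*-identityˡ x) ⟨
    p · (1# * x)               ≈⟨ ×-assoc-* p 1# x ⟨
    (p · 1#) * x               ≈⟨ *-congʳ (φ-·1 p) ⟨
    E.φ (p ·′ Z.1#) * x        ≈⟨ *-congʳ (H.⟦⟧-cong (ℤ/-characteristic p)) ⟩
    E.φ Z.0# * x               ≈⟨ *-congʳ H.0#-homo ⟩
    0# * x                     ≈⟨ zeroˡ x ⟩
    0#                         ∎

  map-f : Pointwise _≈_ (Vec.map E.φ f) (fieldPolynomial d)
  map-f = H.0#-homo ∷ trans (H.-‿homo _) (-‿cong H.1#-homo) ∷ zeros d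
    where
    zeros : ∀ n → Pointwise _≈_ (Vec.map E.φ (replicate n Z.0#)) (replicate n 0#)
    zeros zero    = []
    zeros (suc n) = H.0#-homo ∷ zeros n

  eval-f : ∀ x → eval (Vec.map E.φ f) x ≈ x ^ q - x
  eval-f x = trans (eval-cong x map-f) (eval-fieldPolynomial d x)

  -- Matching on `k ≥ 1` turned the exponent into `suc k`, so `q` is `p` times `p ^ k` and multiples
  -- by `q` vanish. Only the contribution of `-X` is left.
  deriv-f : ∀ x → deriv (Vec.map E.φ f) x ≈ - 1#
  deriv-f x = begin
    deriv (Vec.map E.φ f) x      ≈⟨ deriv-cong x map-f ⟩
    deriv (fieldPolynomial d) x  ≈⟨ deriv-fieldPolynomial d x ⟩
    q · (x ^ suc d) - 1#         ≈⟨ +-congʳ (×-congˡ q≡p^k) ⟩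
    (p ℕ.* p ℕ.^ k) · (x ^ suc d) - 1#
                                 ≈⟨ +-congʳ (×-assocˡ _ p (p ℕ.^ k)) ⟨
    p · ((p ℕ.^ k) · (x ^ suc d)) - 1#
                                 ≈⟨ +-congʳ (characteristic _) ⟩
    0# - 1#                      ≈⟨ +-identityˡ _ ⟩
    - 1#                         ∎

  -- The difference of two roots divides the derivative at the first one, which is `- 1#`; the
  -- inverse is the negated cofactor.
  invertible : ∀ {i j} → i ≢ j → ∃ λ u → (lookup E.roots i - lookup E.roots j) * u ≈ 1#
  invertible {i} {j} i≢j with deriv-factor E.splits i j i≢j
  ... | u , f′≈ = - u , (begin
    (a - b) * - u      ≈⟨ solve 2 (λ c u → c :* (:- u) := :- (c :* u)) refl (a - b) u ⟩
    - ((a - b) * u)    ≈⟨ -‿cong f′≈ ⟨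
    - deriv (Vec.map E.φ f) a
                       ≈⟨ -‿cong (deriv-f a) ⟩
    - - 1#             ≈⟨ -‿involutive 1# ⟩
    1#                 ∎)
    where
    a = lookup E.roots i
    b = lookup E.roots j

  fixed-sub : ∀ {x y} → x ^ q ≈ x → y ^ q ≈ y → (x - y) ^ q ≈ x - y
  fixed-sub {x} {y} = ≡.subst (λ n → x ^ n ≈ x → y ^ n ≈ y → (x - y) ^ n ≈ x - y) (≡.sym q≡p^k)
    (Frobenius.fixed-sub E.S pr characteristic (suc k))

frobeniusRoots : ∀ {p k d} → Prime p → k ≥ 1 → 2 ℕ.+ d ≡ p ℕ.^ k → FrobeniusRoots (2 ℕ.+ d)
frobeniusRoots {p} pr k≥1 q≡p^k =
  splitting⇒frobeniusRoots pr k≥1 q≡p^k (split (ℤ/ p) (ℤ/-nontrivial p pr) _)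

-- Making Frobenius-fixed elements into roots modulo a proper ideal

module _ {q : ℕ} (F : FrobeniusRoots q) where
  open FrobeniusRoots F
  open IntegerCoefficients S using (solve; :1; _:+_; _:*_; _:-_; _:=_)

  -- If `I + (x)` contains 1, then `x` is invertible modulo `I`, so the product of the remaining
  -- factors already lies in `I`. Were this so for every factor, the empty product 1 would end up in
  -- `I`. The double negation stands for the undecided question whether an ideal is proper.
  ∏∈⇒factor-proper : ∀ {n} (I : Ideal S) → Ideal.Proper I → (v : Vec Carrier n) → Ideal.Member I (∏ v) →
          ¬ ¬ ∃ λ i → Ideal.Proper (adjoin I (lookup v i))
  ∏∈⇒factor-proper I proper []      1∈I  _  = proper 1∈I
  ∏∈⇒factor-proper I proper (x ∷ v) xv∈I ¬∃ = ¬¬-excluded-middle λ where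
    (no 1∉I+x)         → ¬∃ (zero , 1∉I+x)
    (yes (c , 1-cx∈I)) → ∏∈⇒factor-proper I proper v
      -- With `y` the remaining product, `y = y * (1 - c * x) + c * (x * y)`, and both summands are
      -- in `I`.
      (Ideal.resp I (solve 3 (λ x c y → y :* (:1 :- c :* x) :+ c :* (x :* y) := y) refl x c (∏ v))
        (Ideal.+-closed I (Ideal.*-closed I (∏ v) 1-cx∈I) (Ideal.*-closed I c xv∈I)))
      λ (i , 1∉) → ¬∃ (suc i , 1∉)

  -- The elements are treated one at a time. For a fixed `b` the product of the differences `b - aᵢ`
  -- is zero, so one of them can be adjoined while the ideal stays proper. Earlier choices persist
  -- because the ideal only grows, and a finite list makes a maximal ideal unnecessary.
  fixed⇒root-modulo : (bs : List Carrier) → All Fixed bs →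
              ¬ ¬ Σ (Ideal S) λ I → Ideal.Proper I × (∀ {b} → b ∈ bs → ∃ λ i → Ideal.Member I (b - lookup roots i))
  fixed⇒root-modulo [] [] ¬∃ = ¬∃ (zeroIdeal , nontrivial , λ ())
  fixed⇒root-modulo (b ∷ bs) (b-fixed ∷ fixed) ¬∃ = fixed⇒root-modulo bs fixed λ (I , proper , rep) →
    ∏∈⇒factor-proper I proper (differences b roots) (Ideal.resp I (sym (fixed⇒∏≈0 b-fixed)) (Ideal.0-member I))
      λ (i , proper′) →
        let d = lookup (differences b roots) i in
        ¬∃ (adjoin I d , proper′ , λ where
          (here ≡.refl)  → i , Ideal.resp (adjoin I d) (reflexive (lookup-map i _ roots)) (∈-adjoin I d)
          (there b∈bs)   → let (j , ∈I) = rep b∈bs in j , ⊆-adjoin I d ∈I)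

-- Affine planes as nets of non-vertical lines

-- L m i j is the label of the line of slope m through the point (i , j).
IsNet : ∀ {q} → (Fin q → Fin q → Fin q → Fin q) → Set
IsNet {q} L = (∀ m i j j′ → L m i j ≡ L m i j′ → j ≡ j′)
            × (∀ i i′ j j′ → i ≢ i′ → ∃ λ m → L m i j ≡ L m i′ j′)
            × (∀ i i′ j j′ m m′ → i ≢ i′ → L m i j ≡ L m i′ j′ → L m′ i j ≡ L m′ i′ j′ → m ≡ m′)

module AffineNet (K : CommutativeRing 0ℓ 0ℓ) (nontrivial : Nontrivial K) where
  open CommutativeRing K
  open IntegerCoefficients K using (solve; _:+_; _:*_; _:-_; _:=_)
  open Algebra.Properties.Ring ring using (x∙y⁻¹≈ε⇒x≈y; x≈y⇒x∙y⁻¹≈ε)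
  open Relation.Binary.Reasoning.Setoid setoid

  -- The label is the index of the intercept `a j - a m * a i` of the line with slope `a m`. The
  -- family `a` need not exhaust `K`: the hypotheses require only these intercepts and the slopes to
  -- be among its values.
  affineNet : ∀ {q} (a : Fin q → Carrier) →
              (∀ {i j} → i ≢ j → ∃ λ u → (a i - a j) * u ≈ 1#) →
              (∀ m i j → ∃ λ l → a j - a m * a i ≈ a l) →
              (∀ i i′ j j′ → i ≢ i′ → ∃ λ m → a j - a j′ ≈ a m * (a i - a i′)) →
              ∃ (IsNet {q})
  affineNet {q} a invertible intercept slope = L , L-injective , L-meet , L-unique
    where
    cancel : ∀ {i j} → i ≢ j → ∀ {x} → x * (a i - a j) ≈ 0# → x ≈ 0#
    cancel {i} {j} i≢j {x} xd≈0 with invertible i≢j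
    ... | u , du≈1 = begin
      x                     ≈⟨ *-identityʳ x ⟨
      x * 1#                ≈⟨ *-congˡ du≈1 ⟨
      x * ((a i - a j) * u) ≈⟨ *-assoc _ _ _ ⟨
      x * (a i - a j) * u   ≈⟨ *-congʳ xd≈0 ⟩
      0# * u                ≈⟨ zeroˡ u ⟩
      0#                    ∎

    a-injective : ∀ {i j} → a i ≈ a j → i ≡ j
    a-injective {i} {j} ai≈aj with i Fin.≟ j
    ... | yes i≡j = i≡j
    -- For distinct indices the difference is a unit; were it zero, cancelling it from
    -- `1# * (a i - a j)` would give `1# ≈ 0#`.
    ... | no  i≢j = contradiction (cancel i≢j (trans (*-identityˡ _) (x≈y⇒x∙y⁻¹≈ε ai≈aj))) nontrivial

    L : Fin q → Fin q → Fin q → Fin q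
    L m i j = proj₁ (intercept m i j)

    L≡⇒ : ∀ {m i j m′ i′ j′} → L m i j ≡ L m′ i′ j′ → a j - a m * a i ≈ a j′ - a m′ * a i′
    L≡⇒ {m} {i} {j} {m′} {i′} {j′} eq = begin
      a j - a m * a i      ≈⟨ proj₂ (intercept m i j) ⟩
      a (L m i j)          ≡⟨ ≡.cong a eq ⟩
      a (L m′ i′ j′)       ≈⟨ proj₂ (intercept m′ i′ j′) ⟨
      a j′ - a m′ * a i′   ∎

    L≡⇒slope : ∀ {m i j i′ j′} → L m i j ≡ L m i′ j′ → a m * (a i - a i′) ≈ a j - a j′
    L≡⇒slope {m} {i} {j} {i′} {j′} eq = begin
      a m * (a i - a i′)
        ≈⟨ solve 4 (λ m i i′ j → m :* (i :- i′) := j :- m :* i′ :- (j :- m :* i)) refl (a m) (a i) (a i′) (a j) ⟩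
      a j - a m * a i′ - (a j - a m * a i)
        ≈⟨ +-congˡ (-‿cong (L≡⇒ eq)) ⟩
      a j - a m * a i′ - (a j′ - a m * a i′)
        ≈⟨ solve 3 (λ c j j′ → j :- c :- (j′ :- c) := j :- j′) refl (a m * a i′) (a j) (a j′) ⟩
      a j - a j′ ∎

    L-injective : ∀ m i j j′ → L m i j ≡ L m i j′ → j ≡ j′
    L-injective m i j j′ eq = a-injective (begin
      a j                              ≈⟨ solve 2 (λ x y → x := x :- y :+ y) refl (a j) (a m * a i) ⟩
      a j - a m * a i + a m * a i      ≈⟨ +-congʳ (L≡⇒ eq) ⟩
      a j′ - a m * a i + a m * a i     ≈⟨ solve 2 (λ x y → x := x :- y :+ y) refl (a j′) (a m * a i) ⟨
      a j′                             ∎)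

    L-meet : ∀ i i′ j j′ → i ≢ i′ → ∃ λ m → L m i j ≡ L m i′ j′
    L-meet i i′ j j′ i≢i′ with slope i i′ j j′ i≢i′
    ... | m , Δ≈ = m , a-injective (begin
      a (L m i j)       ≈⟨ proj₂ (intercept m i j) ⟨
      a j - a m * a i
        ≈⟨ solve 3 (λ c j j′ → j :- c := j :- j′ :- c :+ j′) refl (a m * a i) (a j) (a j′) ⟩
      a j - a j′ - a m * a i + a j′
        ≈⟨ +-congʳ (+-congʳ Δ≈) ⟩
      a m * (a i - a i′) - a m * a i + a j′
        ≈⟨ solve 4 (λ m i i′ j′ → m :* (i :- i′) :- m :* i :+ j′ := j′ :- m :* i′) refl (a m) (a i) (a i′) (a j′) ⟩
      a j′ - a m * a i′ ≈⟨ proj₂ (intercept m i′ j′) ⟩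
      a (L m i′ j′)     ∎)

    -- Both slopes times the unit `a i - a i′` equal `a j - a j′`, so the unit can be cancelled.
    L-unique : ∀ i i′ j j′ m m′ → i ≢ i′ → L m i j ≡ L m i′ j′ → L m′ i j ≡ L m′ i′ j′ → m ≡ m′
    L-unique i i′ j j′ m m′ i≢i′ eq eq′ = a-injective (x∙y⁻¹≈ε⇒x≈y _ _ (cancel i≢i′ (begin
      (a m - a m′) * (a i - a i′)
        ≈⟨ solve 3 (λ m m′ d → (m :- m′) :* d := m :* d :- m′ :* d) refl (a m) (a m′) (a i - a i′) ⟩
      a m * (a i - a i′) - a m′ * (a i - a i′)
        ≈⟨ +-cong (L≡⇒slope eq) (-‿cong (L≡⇒slope eq′)) ⟩
      a j - a j′ - (a j - a j′)
        ≈⟨ -‿inverseʳ _ ⟩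
      0# ∎)))

-- All intercepts and slopes built from the roots are fixed by the `q`-th power map, and there are
-- finitely many. A single proper ideal therefore makes all of them congruent to roots, and the net
-- lives over its quotient.
¬¬net : ∀ {q} → FrobeniusRoots q → ¬ ¬ ∃ (IsNet {q})
¬¬net {q} F ¬net = fixed⇒root-modulo F elements elements-fixed λ (I , proper , rep) →
  ¬net (AffineNet.affineNet (quotient I) (quotient-nontrivial I proper) a
    (λ i≢j → let u , eq = invertible i≢j in u , ≈⇒≋ I eq)
    (λ m i j → rep (∈-++⁺ˡ (∈-map⁺ intercept (∈-triples m i j))))
    (λ i i′ j j′ i≢i′ →
      let m , Δu≋am = rep (∈-++⁺ʳ (List.map intercept triples)
                        (∈-map⁺ slope (∈-cartesianProduct⁺ (∈-allFin i) (∈-triples i′ j j′))))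
          open CommutativeRing (quotient I) using () renaming (trans to ≋-trans; *-congʳ to ≋-*-congʳ)
      in m , ≋-trans (≈⇒≋ I (slope-spec i i′ j j′ i≢i′)) (≋-*-congʳ Δu≋am)))
  where
  open FrobeniusRoots F
  open IntegerCoefficients S using (solve; _:*_; _:=_)
  open Relation.Binary.Reasoning.Setoid setoid

  a : Fin q → Carrier
  a = lookup roots

  inverse : Fin q → Fin q → Carrier
  inverse i i′ with i Fin.≟ i′
  -- A dummy value for equal indices. It is chosen to be fixed, because `elements` lists the slopes
  -- of all quadruples, including those with `i ≡ i′`.
  ... | yes _   = a i
  ... | no i≢i′ = proj₁ (invertible i≢i′)

  inverse-fixed : ∀ i i′ → Fixed (inverse i i′)
  inverse-fixed i i′ with i Fin.≟ i′
  ... | yes _   = roots-fixed i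
  ... | no i≢i′ = Frobenius.fixed-inverse S q (fixed-sub (roots-fixed i) (roots-fixed i′)) (proj₂ (invertible i≢i′))

  inverse-spec : ∀ i i′ → i ≢ i′ → (a i - a i′) * inverse i i′ ≈ 1#
  inverse-spec i i′ i≢i′ with i Fin.≟ i′
  ... | yes i≡i′ = contradiction i≡i′ i≢i′
  ... | no i≢i′  = proj₂ (invertible i≢i′)

  intercept : Fin q × Fin q × Fin q → Carrier
  intercept (m , i , j) = a j - a m * a i

  slope : Fin q × Fin q × Fin q × Fin q → Carrier
  slope (i , i′ , j , j′) = (a j - a j′) * inverse i i′

  slope-spec : ∀ i i′ j j′ → i ≢ i′ → a j - a j′ ≈ slope (i , i′ , j , j′) * (a i - a i′)
  slope-spec i i′ j j′ i≢i′ = begin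
    a j - a j′                                     ≈⟨ *-identityʳ _ ⟨
    (a j - a j′) * 1#                              ≈⟨ *-congˡ (inverse-spec i i′ i≢i′) ⟨
    (a j - a j′) * ((a i - a i′) * inverse i i′)   ≈⟨ solve 3 (λ x y z → x :* (y :* z) := x :* z :* y) refl _ _ _ ⟩
    (a j - a j′) * inverse i i′ * (a i - a i′)     ∎

  triples : List (Fin q × Fin q × Fin q)
  triples = cartesianProduct (allFin q) (cartesianProduct (allFin q) (allFin q))

  ∈-triples : ∀ m i j → (m , i , j) ∈ triples
  ∈-triples m i j = ∈-cartesianProduct⁺ (∈-allFin m) (∈-cartesianProduct⁺ (∈-allFin i) (∈-allFin j))

  elements : List Carrier
  elements = List.map intercept triples ++ List.map slope (cartesianProduct (allFin q) triples)

  elements-fixed : All Fixed elements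
  elements-fixed = All.++⁺
    (All.map⁺ (All.universal (λ (m , i , j) →
      fixed-sub (roots-fixed j) (Frobenius.fixed-mul S q (roots-fixed m) (roots-fixed i))) triples))
    (All.map⁺ (All.universal (λ (i , i′ , j , j′) →
      Frobenius.fixed-mul S q (fixed-sub (roots-fixed j) (roots-fixed j′)) (inverse-fixed i i′)) _))

-- Removing the double negation by finite search

open import Data.Nat using (_*_; _^_)

isNet? : ∀ {q} (L : Fin q → Fin q → Fin q → Fin q) → Dec (IsNet L)
isNet? L =
  (Fin.all? λ m → Fin.all? λ i → Fin.all? λ j → Fin.all? λ j′ →
    (L m i j Fin.≟ L m i j′) →-dec (j Fin.≟ j′))
  ×-dec
  (Fin.all? λ i → Fin.all? λ i′ → Fin.all? λ j → Fin.all? λ j′ →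
    ¬? (i Fin.≟ i′) →-dec (Fin.any? λ m → L m i j Fin.≟ L m i′ j′))
  ×-dec
  (Fin.all? λ i → Fin.all? λ i′ → Fin.all? λ j → Fin.all? λ j′ → Fin.all? λ m → Fin.all? λ m′ →
    ¬? (i Fin.≟ i′) →-dec ((L m i j Fin.≟ L m i′ j′) →-dec ((L m′ i j Fin.≟ L m′ i′ j′) →-dec (m Fin.≟ m′))))

-- Decoding an encoded table returns the original function only pointwise, so the property must be
-- transported along pointwise equality.
isNet-resp : ∀ {q} {L L′ : Fin q → Fin q → Fin q → Fin q} → (∀ m i j → L′ m i j ≡ L m i j) → IsNet L → IsNet L′
isNet-resp {L = L} {L′} L′≗L (injective , meet , unique) =
    (λ m i j j′ eq → injective m i j j′ (to eq))
  , (λ i i′ j j′ i≢i′ → let m , eq = meet i i′ j j′ i≢i′ in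
       m , ≡.trans (L′≗L m i j) (≡.trans eq (≡.sym (L′≗L m i′ j′))))
  , (λ i i′ j j′ m m′ i≢i′ eq eq′ → unique i i′ j j′ m m′ i≢i′ (to eq) (to eq′))
  where
  to : ∀ {m i j m′ i′ j′} → L′ m i j ≡ L′ m′ i′ j′ → L m i j ≡ L m′ i′ j′
  to eq = ≡.trans (≡.sym (L′≗L _ _ _)) (≡.trans eq (L′≗L _ _ _))

-- Candidate nets are finite tables and `IsNet` is decidable, so the existence of a net is decidable
-- and hence stable under double negation.
net-stable : ∀ {q} → ¬ ¬ ∃ (IsNet {q}) → ∃ (IsNet {q})
net-stable {q} ¬¬net = let x , net = decidable-stable (Fin.any? λ x → isNet? (decode x)) ¬¬code in decode x , net
  where
  -- A table assigns one of `q` labels to each of the `q * (q * q)` triples `(m , i , j)`.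
  decode : Fin (q ^ (q * (q * q))) → Fin q → Fin q → Fin q → Fin q
  decode x m i j = finToFun x (combine m (combine i j))

  tabulate : (Fin q → Fin q → Fin q → Fin q) → Fin (q * (q * q)) → Fin q
  tabulate L x = uncurry (λ m ij → uncurry (L m) (remQuot q ij)) (remQuot (q * q) x)

  decode-encode : ∀ L m i j → decode (funToFin (tabulate L)) m i j ≡ L m i j
  decode-encode L m i j = begin
    finToFun (funToFin (tabulate L)) (combine m (combine i j))
      ≡⟨ Fin.finToFun-funToFin (tabulate L) (combine m (combine i j)) ⟩
    tabulate L (combine m (combine i j))
      ≡⟨ ≡.cong (uncurry λ m ij → uncurry (L m) (remQuot q ij)) (Fin.remQuot-combine m (combine i j)) ⟩
    uncurry (L m) (remQuot q (combine i j))
      ≡⟨ ≡.cong (uncurry (L m)) (Fin.remQuot-combine i j) ⟩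
    L m i j ∎
    where open ≡.≡-Reasoning

  ¬¬code : ¬ ¬ ∃ λ x → IsNet (decode x)
  ¬¬code ¬code = ¬¬net λ (L , net) → ¬code (funToFin (tabulate L) , isNet-resp (decode-encode L) net)

primePower⇒net : ∀ {r} → IsPrimePower r → ∃ (IsNet {r})
-- Orders 0 and 1 fall outside the shape `suc (suc d)` under which X^r - X is monic of degree `r`;
-- they get trivial nets directly.
primePower⇒net {zero} _ = (λ ()) , (λ ()) , (λ ()) , (λ ())
primePower⇒net {1}    _ =
    (λ _ _ j → j)
  , (λ _ _ _ _ eq → eq)
  , (λ { zero zero _ _ 0≢0 → contradiction ≡.refl 0≢0 })
  , (λ { _ _ _ _ zero zero _ _ _ → ≡.refl })
primePower⇒net {suc (suc d)} (p , k , pr , k≥1 , r≡p^k) = net-stable (¬¬net (frobeniusRoots pr k≥1 r≡p^k))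

-- Colouring edges by direction in the blown-up plane

constant-along : ∀ {A : Set} {n} (g : Fin (suc n) → A) → (∀ i → g (inject₁ i) ≡ g (suc i)) → ∀ i → g i ≡ g zero
constant-along g step zero = ≡.refl
constant-along {n = suc n} g step (suc i) =
  ≡.trans (constant-along (λ j → g (suc j)) (λ j → step (suc j)) i) (≡.sym (step zero))

module NetColouring {r : ℕ} (L : Fin r → Fin r → Fin r → Fin r) (net : IsNet L) (s : ℕ) where

  L-injective = proj₁ net
  L-meet      = proj₁ (proj₂ net)
  L-unique    = proj₂ (proj₂ net)

  -- The r² points of the plane, each blown up to s vertices.
  column row : Fin (r * (s * r)) → Fin r
  copy : Fin (r * (s * r)) → Fin s
  column v = proj₁ (remQuot (s * r) v)
  copy   v = proj₁ (remQuot {s} r (proj₂ (remQuot {r} (s * r) v)))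
  row    v = proj₂ (remQuot {s} r (proj₂ (remQuot {r} (s * r) v)))

  coordinates-injective : ∀ {u v} → column u ≡ column v → copy u ≡ copy v → row u ≡ row v → u ≡ v
  coordinates-injective {u} {v} eq₁ eq₂ eq₃ = begin
    u                                              ≡⟨ Fin.combine-remQuot {r} (s * r) u ⟨
    combine (column u) (proj₂ (remQuot {r} (s * r) u))
      ≡⟨ ≡.cong (combine (column u)) (Fin.combine-remQuot {s} r (proj₂ (remQuot {r} (s * r) u))) ⟨
    combine (column u) (combine (copy u) (row u))  ≡⟨ ≡.cong₂ combine eq₁ (≡.cong₂ combine eq₂ eq₃) ⟩
    combine (column v) (combine (copy v) (row v))
      ≡⟨ ≡.cong (combine (column v)) (Fin.combine-remQuot {s} r (proj₂ (remQuot {r} (s * r) v))) ⟩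
    combine (column v) (proj₂ (remQuot {r} (s * r) v))
      ≡⟨ Fin.combine-remQuot {r} (s * r) v ⟩
    v                                              ∎
    where open ≡.≡-Reasoning

  -- Colour `zero` is the vertical direction, which `L` does not describe. It also takes the edges
  -- between copies of one point, since these share a column.
  direction : Fin (r * (s * r)) → Fin (r * (s * r)) → Fin (suc r)
  direction u v with column u Fin.≟ column v
  ... | yes _  = zero
  ... | no i≢i′ = suc (proj₁ (L-meet (column u) (column v) (row u) (row v) i≢i′))

  -- `L-meet` chooses a slope for each ordered pair; uniqueness makes the two choices agree.
  direction-sym : ∀ u v → direction v u ≡ direction u v
  direction-sym u v with column u Fin.≟ column v | column v Fin.≟ column u
  ... | yes _   | yes _    = ≡.refl
  ... | yes eq  | no i′≢i  = contradiction (≡.sym eq) i′≢i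
  ... | no i≢i′ | yes eq   = contradiction (≡.sym eq) i≢i′
  ... | no i≢i′ | no i′≢i  = ≡.cong suc (L-unique _ _ _ _ _ _ i≢i′
    (≡.sym (proj₂ (L-meet (column v) (column u) (row v) (row u) i′≢i)))
    (proj₂ (L-meet (column u) (column v) (row u) (row v) i≢i′)))

  direction≡0 : ∀ u v → direction u v ≡ zero → column u ≡ column v
  direction≡0 u v eq with column u Fin.≟ column v
  direction≡0 u v eq | yes i≡i′ = i≡i′
  direction≡0 u v () | no _

  direction≡suc : ∀ {m} u v → direction u v ≡ suc m → L m (column u) (row u) ≡ L m (column v) (row v)
  direction≡suc u v eq with column u Fin.≟ column v
  direction≡suc u v ()     | yes _
  direction≡suc u v ≡.refl | no i≢i′ = proj₂ (L-meet _ _ _ _ i≢i′)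

  colouring : (G : SimpleGraph (r * (s * r))) → EdgeColouring G (suc r)
  colouring G = record
    { colour     = λ {u} {v} _ → direction u v
    ; colour-sym = λ {u} {v} _ → direction-sym u v
    }

  -- A path with `s * r` edges has one vertex more, all on a single line by `constant-along`. That
  -- line has just `s * r` vertices, so the pigeonhole principle contradicts injectivity. On a
  -- vertical line copy and row determine the vertex.
  no-long-path : ∀ {G} c → ¬ MonoPath (colouring G) c (s * r)
  no-long-path zero path =
    let x , y , x<y , eq = Fin.pigeonhole (ℕ.n<1+n _) λ x → combine (copy (vertex x)) (row (vertex x))
        copy≡ , row≡ = Fin.combine-injective _ _ _ _ eq
    in Fin.<⇒≢ x<y (injective (coordinates-injective (≡.trans (vertical x) (≡.sym (vertical y))) copy≡ row≡))
    where
    open MonoPath path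
    vertical : ∀ x → column (vertex x) ≡ column (vertex zero)
    vertical = constant-along _ λ i → direction≡0 _ _ (edge-colour i)
  no-long-path (suc m) path =
    -- A non-vertical line meets each column in one point, so here copy and column determine the
    -- vertex.
    let x , y , x<y , eq = Fin.pigeonhole (ℕ.n<1+n _) λ x → combine (copy (vertex x)) (column (vertex x))
        copy≡ , column≡ = Fin.combine-injective _ _ _ _ eq
    in Fin.<⇒≢ x<y (injective (coordinates-injective column≡ copy≡ (row≡ x y column≡)))
    where
    open MonoPath path
    line : Fin (suc (s * r)) → Fin r
    line x = L m (column (vertex x)) (row (vertex x))
    collinear : ∀ x → line x ≡ line zero
    collinear = constant-along line λ i → direction≡suc _ _ (edge-colour i)
    row≡ : ∀ x y → column (vertex x) ≡ column (vertex y) → row (vertex x) ≡ row (vertex y)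
    row≡ x y column≡ = L-injective m (column (vertex x)) _ _
      (≡.trans (≡.trans (collinear x) (≡.sym (collinear y))) (≡.cong (λ i → L m i (row (vertex y))) (≡.sym column≡)))

theorem5p2 : ∀ (n N r : ℕ) → n ≥ 1 → N ≥ 1 → N ≡ r * n → IsPrimePower r → r ∣ n →
    (G : SimpleGraph N) → NoMonoPathColouring G (suc r) n
-- The quotient `s` of `n` by `r` is the number of copies of each point: `n` becomes `s * r`, the
-- size of a blown-up line, and `N` becomes `r * (s * r)`.
theorem5p2 _ _ r _ _ ≡.refl primePower (divides s ≡.refl) G = colouring G , no-long-path
  where open NetColouring (proj₁ (primePower⇒net primePower)) (proj₂ (primePower⇒net primePower)) s
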